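{- Let $p>3$ be a prime and let $d\in\{0,1,\ldots,(p-1)/2\}$. Then $$\sum_{k=0}^{(p-1)/2}\frac{\binom{2k}k\binom{2k+2d}{k+d}}{16^k}\equiv 4^d\left(\frac{ -1}p\right)\pmod{p^2},$$ and moreover $$\sum_{k=0}^{(p-1)/2}\frac{\binom{2k}k\binom{2k}{k+d}}{16^k}\equiv\left(\frac{ -1}p\right)+p^2\frac{(-1)^d}4E_{p-3}\left(d+\frac12\right)\pmod{p^3}.$$
   Context: $\left(\frac{\cdot}{p}\right)$ is the Legendre symbol. $E_n(x)$ denotes the Euler polynomial of degree $n$, defined by $\frac{2e^{xt}}{e^t+1}=\sum_{n\ge0}E_n(x)\frac{t^n}{n!}$. For rational numbers $a,b$ whose denominators are not divisible by $p$, $a\equiv b\pmod{p^m}$ means $(a-b)/p^m$ has denominator not divisible by $p$. -}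

module Defs where

open import Data.Nat as ℕ using (ℕ; zero; suc)
open import Data.Nat.Combinatorics using (_C_)
open import Data.Integer as ℤ using (ℤ; +_)
open import Data.Integer.DivMod using (_%ℕ_)
open import Data.Rational as ℚ using (ℚ; _/_; ↧ₙ_)
open import Data.List using (List; []; _∷_; upTo)
open import Data.Bool.ListAction using (any)
open import Data.Bool using (Bool; true; false; if_then_else_)
open import Data.Product using (Σ; _×_)
open import Relation.Binary.PropositionalEquality using (_≡_)
open import Data.Nat.Divisibility using (_∣_)
open import Relation.Nullary using (¬_)

ℕ→ℚ : ℕ → ℚ
ℕ→ℚ n = (+ n) / 1

ℤ→ℚ : ℤ → ℚ
ℤ→ℚ z = z / 1

legendre : ℤ → ℕ → ℤ
legendre a zero = ℤ.0ℤ
legendre a (suc n) with a %ℕ (suc n)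
... | zero = ℤ.0ℤ
... | suc _ =
  if any (λ x → ((+ x) ℤ.* (+ x) ℤ.- a) %ℕ (suc n) ℕ.≡ᵇ 0) (upTo (suc n))
  then ℤ.1ℤ else ℤ.-1ℤ

powℚ : ℚ → ℕ → ℚ
powℚ x zero = ℚ.1ℚ
powℚ x (suc n) = x ℚ.* powℚ x n

sumTo : ℕ → (ℕ → ℚ) → ℚ
sumTo zero f = f 0
sumTo (suc n) f = sumTo n f ℚ.+ f (suc n)

-- Euler polynomials E_n(x), from 2e^{xt}/(e^t+1) = Σ E_n(x) t^n/n!.
-- Comparing coefficients of t^n in 2e^{xt} = (e^t+1) Σ E_n(x) t^n/n! gives
--   E_n(x) = x^n - (1/2) Σ_{k=0}^{n-1} C(n,k) E_k(x).
-- eulerList n x = [E_n(x), E_{n-1}(x), …, E_0(x)]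
eulerList : ℕ → ℚ → List ℚ
eulerList zero x = ℚ.1ℚ ∷ []
eulerList (suc n) x = (powℚ x (suc n) ℚ.- ℚ.½ ℚ.* go (suc n) n prev) ∷ prev
  where
  prev = eulerList n x
  go : ℕ → ℕ → List ℚ → ℚ
  go m j [] = ℚ.0ℚ
  go m zero (e ∷ es) = ℕ→ℚ (m C 0) ℚ.* e
  go m (suc j) (e ∷ es) = ℕ→ℚ (m C suc j) ℚ.* e ℚ.+ go m j es

eulerPoly : ℕ → ℚ → ℚ
eulerPoly n x with eulerList n x
... | [] = ℚ.0ℚ
... | e ∷ _ = e

_≡_[mod_^_] : ℚ → ℚ → ℕ → ℕ → Set
a ≡ b [mod p ^ m ] =
  Σ ℚ (λ c → (¬ (p ∣ ↧ₙ c)) × (a ℚ.- b ≡ ℕ→ℚ (p ℕ.^ m) ℚ.* c))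

{-# OPTIONS --safe #-}

-- Write n = (p-1)/2, S(d) = Σ_{k≤n} C(2k,k) C(2k,k+d) / 16^k and u = C(2n,n) / 16^n.
-- Induction on the upper limit of summation gives the exact identity
--   (2d+1) (S(d) - S(d+1)) = p u C(p,n+d+1).
-- Its right side is p² u C(p-1,n+d) / (n+d+1), so S(d) - S(d+1) ≡ 2 p² (-1)^d / (2d+1)² (mod p³),
-- which by E_m(x+1) + E_m(x) = 2 x^m and Fermat is also the difference of the values claimed at d
-- and d+1. At d = n, where S(n) = u and E_{p-3}(p/2) ≡ E_{p-3}(0) = 0 (mod p), the claim is
-- Morley's congruence u ≡ (-1)^n (mod p³). The first congruence follows from S(d) ≡ (-1)^n (mod p²)
-- for |d| ≤ n by Pascal's rule, and (-1)^n is the Legendre symbol by Wilson and Fermat.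
module Submission where

open import Defs
open import Data.Nat as ℕ using (ℕ; zero; suc; z≤n; s≤s; _!)
import Data.Nat.Properties as ℕₚ
open import Data.Nat.Combinatorics using (_C_; nCn≡1; nC1≡n; k>n⇒nCk≡0; nCk≡nC[n∸k]; nCk+nC[k+1]≡[n+1]C[k+1])
open import Data.Nat.DivMod using (m%n<n; m≡m%n+[m/n]*n; m*n/n≡m)
open import Data.Nat.Divisibility using (_∣_; _∤_; divides; ∣-refl; ∣m+n∣m⇒∣n; n∣m*n; m∣m*n; ∣n⇒∣m*n; ∣⇒≤; _∣0; n∣m⇒m%n≡0; m%n≡0⇒n∣m)
open import Data.Nat.Primality using (Prime; euclidsLemma; prime⇒nonTrivial; prime⇒irreducible)
import Data.Nat.Coprimality as Coprime
open import Data.Integer as ℤ using (ℤ)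
import Data.Integer.Properties as ℤₚ
open import Data.Rational as ℚ using (ℚ; 0ℚ; 1ℚ; ½; mkℚ; ↥_; ↧_; ↧ₙ_; toℚᵘ)
import Data.Rational.Properties as ℚₚ
open import Data.Rational.Unnormalised as ℚᵘ using (mkℚᵘ; *≡*)
import Data.Rational.Unnormalised.Properties as ℚᵘₚ
open import Data.Integer.DivMod using (_%ℕ_)
open import Data.Bool using (Bool; true; false; if_then_else_; T)
open import Data.List using (List; []; _∷_; upTo)
open import Data.List.Membership.Propositional using (find; lose)
open import Data.List.Membership.Propositional.Properties using (∈-upTo⁺)
open import Data.List.Relation.Unary.Any.Properties using (any⁺; any⁻)
open import Data.Product using (Σ; _×_; _,_; proj₁; proj₂; ∃)
open import Data.Sum using (_⊎_; inj₁; inj₂; [_,_]′)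
open import Function using (_∘_)
open import Level using (0ℓ)
open import Relation.Binary using (Setoid)
import Relation.Binary.Reasoning.Setoid as ≈-Reasoning
open import Relation.Binary.PropositionalEquality
open import Relation.Nullary using (¬_; contradiction)
open import Relation.Nullary.Decidable using (dec⇒maybe)
open import Tactic.RingSolver using (solve-∀)
import Data.Nat.Tactic.RingSolver as ℕ-RingSolver
open import Tactic.RingSolver.Core.AlmostCommutativeRing using (AlmostCommutativeRing; fromCommutativeRing)

-- The right side of the difference identity already carries p², so whatever multiplies it matters
-- only modulo p (`≈-scale`); Morley's congruence alone is needed to the full p³. It comes from the
-- product of p² - (2i+1)² over i < n. That product equals (1·3···(2n-1))² / u exactly, because each
-- factor splits as 4(n-i)(n+i+1). Modulo p³ it is (-1)^n (1·3···(2n-1))² (1 - p² Σ (2i+1)^(-2)),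
-- and the sum vanishes modulo p. Inverse squares are written as powers with exponent p-3, which is
-- also how that index of the Euler polynomial arises. The passage to the first congruence amounts
-- to C(2k+2d,k+d) = Σ_j C(2d,j) C(2k,k+d-j): the weights add up to 4^d, and the symmetry of the row
-- takes care of negative offsets.

module Lemmas where

  open Defs using () renaming (ℕ→ℚ to ι; ℤ→ℚ to ζ)
  open import Data.Rational using (_+_; _*_; _-_; -_)

  -- The embeddings of ℕ and ℤ into ℚ, powers and sums

  ring : AlmostCommutativeRing 0ℓ 0ℓ
  ring = fromCommutativeRing ℚₚ.+-*-commutativeRing (λ x → dec⇒maybe (0ℚ ℚₚ.≟ x))

  ζ-toℚᵘ : ∀ z → toℚᵘ (ζ z) ℚᵘ.≃ mkℚᵘ z 0
  ζ-toℚᵘ z = ℚₚ.toℚᵘ-fromℚᵘ (mkℚᵘ z 0)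

  ζ-+ : ∀ a b → ζ (a ℤ.+ b) ≡ ζ a + ζ b
  ζ-+ a b = ℚₚ.toℚᵘ-injective (begin
    toℚᵘ (ζ (a ℤ.+ b))             ≈⟨ ζ-toℚᵘ (a ℤ.+ b) ⟩
    mkℚᵘ (a ℤ.+ b) 0               ≈⟨ *≡* (cong (ℤ._* ℤ.1ℤ) (cong₂ ℤ._+_ (ℤₚ.*-identityʳ a) (ℤₚ.*-identityʳ b))) ⟨
    mkℚᵘ a 0 ℚᵘ.+ mkℚᵘ b 0         ≈⟨ ℚᵘₚ.+-cong (ζ-toℚᵘ a) (ζ-toℚᵘ b) ⟨
    toℚᵘ (ζ a) ℚᵘ.+ toℚᵘ (ζ b)     ≈⟨ ℚₚ.toℚᵘ-homo-+ (ζ a) (ζ b) ⟨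
    toℚᵘ (ζ a + ζ b)               ∎)
    where open ℚᵘₚ.≃-Reasoning

  ζ-* : ∀ a b → ζ (a ℤ.* b) ≡ ζ a * ζ b
  ζ-* a b = ℚₚ.toℚᵘ-injective (begin
    toℚᵘ (ζ (a ℤ.* b))             ≈⟨ ζ-toℚᵘ (a ℤ.* b) ⟩
    mkℚᵘ a 0 ℚᵘ.* mkℚᵘ b 0         ≈⟨ ℚᵘₚ.*-cong (ζ-toℚᵘ a) (ζ-toℚᵘ b) ⟨
    toℚᵘ (ζ a) ℚᵘ.* toℚᵘ (ζ b)     ≈⟨ ℚₚ.toℚᵘ-homo-* (ζ a) (ζ b) ⟨
    toℚᵘ (ζ a * ζ b)               ∎)
    where open ℚᵘₚ.≃-Reasoning

  ζ-neg : ∀ a → ζ (ℤ.- a) ≡ - ζ a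
  ζ-neg a = begin
    ζ (ℤ.- a)                   ≡⟨ cancel (ζ (ℤ.- a)) (ζ a) ⟩
    ζ (ℤ.- a) + ζ a - ζ a       ≡⟨ cong (_- ζ a) (ζ-+ (ℤ.- a) a) ⟨
    ζ (ℤ.- a ℤ.+ a) - ζ a       ≡⟨ cong (λ z → ζ z - ζ a) (ℤₚ.+-inverseˡ a) ⟩
    0ℚ - ζ a                    ≡⟨ ℚₚ.+-identityˡ (- ζ a) ⟩
    - ζ a                       ∎
    where
    open ≡-Reasoning
    cancel : ∀ x y → x ≡ x + y - y
    cancel = solve-∀ ring

  ζ-injective : ∀ {a b} → ζ a ≡ ζ b → a ≡ b
  ζ-injective {a} {b} eq with
    ℚᵘₚ.≃-trans (ℚᵘₚ.≃-sym (ζ-toℚᵘ a)) (ℚᵘₚ.≃-trans (ℚₚ.toℚᵘ-cong eq) (ζ-toℚᵘ b))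
  ... | *≡* a1≡b1 = trans (sym (ℤₚ.*-identityʳ a)) (trans a1≡b1 (ℤₚ.*-identityʳ b))

  ι-+ : ∀ m n → ι (m ℕ.+ n) ≡ ι m + ι n
  ι-+ m n = ζ-+ (ℤ.+ m) (ℤ.+ n)

  ι-* : ∀ m n → ι (m ℕ.* n) ≡ ι m * ι n
  ι-* m n = trans (cong ζ (ℤₚ.pos-* m n)) (ζ-* (ℤ.+ m) (ℤ.+ n))

  ι-suc : ∀ n → ι (suc n) ≡ 1ℚ + ι n
  ι-suc n = ι-+ 1 n

  ι-^ : ∀ m n → ι (m ℕ.^ n) ≡ powℚ (ι m) n
  ι-^ m zero    = refl
  ι-^ m (suc n) = trans (ι-* m (m ℕ.^ n)) (cong (ι m *_) (ι-^ m n))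

  ι-∸ : ∀ {m n} → m ℕ.≤ n → ι (n ℕ.∸ m) ≡ ι n - ι m
  ι-∸ {m} {n} m≤n = begin
    ι (n ℕ.∸ m)                ≡⟨ cancel (ι (n ℕ.∸ m)) (ι m) ⟩
    ι (n ℕ.∸ m) + ι m - ι m    ≡⟨ cong (_- ι m) (ι-+ (n ℕ.∸ m) m) ⟨
    ι (n ℕ.∸ m ℕ.+ m) - ι m    ≡⟨ cong (λ k → ι k - ι m) (ℕₚ.m∸n+n≡m m≤n) ⟩
    ι n - ι m                  ∎
    where
    open ≡-Reasoning
    cancel : ∀ x y → x ≡ x + y - y
    cancel = solve-∀ ring

  num/den : ∀ x → x * ι (↧ₙ x) ≡ ζ (↥ x)
  num/den x@(mkℚ _ _ _) = ℚₚ.toℚᵘ-injective (begin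
    toℚᵘ (x * ι (↧ₙ x))                    ≈⟨ ℚₚ.toℚᵘ-homo-* x (ι (↧ₙ x)) ⟩
    toℚᵘ x ℚᵘ.* toℚᵘ (ι (↧ₙ x))            ≈⟨ ℚᵘₚ.*-congˡ {toℚᵘ x} (ζ-toℚᵘ (↧ x)) ⟩
    toℚᵘ x ℚᵘ.* mkℚᵘ (↧ x) 0               ≈⟨ *≡* (trans (ℤₚ.*-identityʳ (↥ x ℤ.* ↧ x)) (cong (λ k → ↥ x ℤ.* k) (sym (trans (ℤₚ.pos-* (↧ₙ x) 1) (ℤₚ.*-identityʳ (↧ x)))))) ⟩
    mkℚᵘ (↥ x) 0                           ≈⟨ ζ-toℚᵘ (↥ x) ⟨
    toℚᵘ (ζ (↥ x))                         ∎)
    where open ℚᵘₚ.≃-Reasoning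

  powℚ-+ : ∀ x m n → powℚ x (m ℕ.+ n) ≡ powℚ x m * powℚ x n
  powℚ-+ x zero    n = sym (ℚₚ.*-identityˡ (powℚ x n))
  powℚ-+ x (suc m) n = trans (cong (x *_) (powℚ-+ x m n)) (sym (ℚₚ.*-assoc x (powℚ x m) (powℚ x n)))

  powℚ-* : ∀ x y n → powℚ (x * y) n ≡ powℚ x n * powℚ y n
  powℚ-* x y zero    = refl
  powℚ-* x y (suc n) = trans (cong (x * y *_) (powℚ-* x y n)) (interchange x y (powℚ x n) (powℚ y n))
    where
    interchange : ∀ a b c d → a * b * (c * d) ≡ a * c * (b * d)
    interchange = solve-∀ ring

  powℚ-1 : ∀ n → powℚ 1ℚ n ≡ 1ℚ
  powℚ-1 zero    = refl
  powℚ-1 (suc n) = trans (ℚₚ.*-identityˡ (powℚ 1ℚ n)) (powℚ-1 n)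

  powℚ-powℚ : ∀ x m n → powℚ (powℚ x m) n ≡ powℚ x (m ℕ.* n)
  powℚ-powℚ x zero    n = powℚ-1 n
  powℚ-powℚ x (suc m) n = begin
    powℚ (x * powℚ x m) n            ≡⟨ powℚ-* x (powℚ x m) n ⟩
    powℚ x n * powℚ (powℚ x m) n     ≡⟨ cong (powℚ x n *_) (powℚ-powℚ x m n) ⟩
    powℚ x n * powℚ x (m ℕ.* n)      ≡⟨ powℚ-+ x n (m ℕ.* n) ⟨
    powℚ x (n ℕ.+ m ℕ.* n)           ∎
    where open ≡-Reasoning

  sgn : ℕ → ℚ
  sgn = powℚ (- 1ℚ)

  sgn² : ∀ n → sgn n * sgn n ≡ 1ℚ
  sgn² n = trans (sym (powℚ-* (- 1ℚ) (- 1ℚ) n)) (powℚ-1 n)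

  sumTo-cong : ∀ n {f g : ℕ → ℚ} → (∀ k → f k ≡ g k) → sumTo n f ≡ sumTo n g
  sumTo-cong zero    f≗g = f≗g 0
  sumTo-cong (suc n) f≗g = cong₂ _+_ (sumTo-cong n f≗g) (f≗g (suc n))

  sumTo-+ : ∀ n (f g : ℕ → ℚ) → sumTo n (λ k → f k + g k) ≡ sumTo n f + sumTo n g
  sumTo-+ zero    f g = refl
  sumTo-+ (suc n) f g =
    trans (cong (_+ (f (suc n) + g (suc n))) (sumTo-+ n f g))
          (interchange (sumTo n f) (sumTo n g) (f (suc n)) (g (suc n)))
    where
    interchange : ∀ a b c d → a + b + (c + d) ≡ a + c + (b + d)
    interchange = solve-∀ ring

  sumTo-suc : ∀ n (f : ℕ → ℚ) → sumTo (suc n) f ≡ f 0 + sumTo n (f ∘ suc)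
  sumTo-suc zero    f = refl
  sumTo-suc (suc n) f =
    trans (cong (_+ f (suc (suc n))) (sumTo-suc n f)) (ℚₚ.+-assoc (f 0) (sumTo n (f ∘ suc)) (f (suc (suc n))))

  -- Congruences between rational numbers

  -- Any fraction will do here, reduced or not, so sums and products close without passing to lowest
  -- terms; `integral⇒p∤den` returns to the reduced denominator of which the theorem speaks.
  record Integral (p : ℕ) (x : ℚ) : Set where
    constructor fraction
    field
      num     : ℤ
      den     : ℕ
      p∤den   : p ∤ den
      x*den   : x * ι den ≡ ζ num

  module Local (p : ℕ) (p-prime : Prime p) where

    p∤1 : p ∤ 1
    p∤1 p∣1 = ℕₚ.<-irrefl refl
      (ℕₚ.<-≤-trans (ℕ.nonTrivial⇒n>1 p {{prime⇒nonTrivial p-prime}}) (∣⇒≤ p∣1))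

    p∤* : ∀ {a b} → p ∤ a → p ∤ b → p ∤ a ℕ.* b
    p∤* {a} {b} p∤a p∤b p∣ab with euclidsLemma a b p-prime p∣ab
    ... | inj₁ p∣a = p∤a p∣a
    ... | inj₂ p∣b = p∤b p∣b


    <⇒p∤ : ∀ {k} .{{_ : ℕ.NonZero k}} → k ℕ.< p → p ∤ k
    <⇒p∤ k<p p∣k = ℕₚ.<-irrefl refl (ℕₚ.<-≤-trans k<p (∣⇒≤ p∣k))

    num-den-coprime : ∀ x → Coprime.Coprime ℤ.∣ ↥ x ∣ (↧ₙ x)
    num-den-coprime (mkℚ _ _ coprime) = Coprime.recompute coprime

    cross-multiply : ∀ x a b c d → x * ι b ≡ ζ a → x * ι d ≡ ζ c → ℤ.∣ c ∣ ℕ.* b ≡ ℤ.∣ a ∣ ℕ.* d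
    cross-multiply x a b c d xb≡a xd≡c = begin
      ℤ.∣ c ∣ ℕ.* b           ≡⟨ ℤₚ.abs-* c (ℤ.+ b) ⟨
      ℤ.∣ c ℤ.* (ℤ.+ b) ∣     ≡⟨ cong ℤ.∣_∣ (ζ-injective {c ℤ.* (ℤ.+ b)} {a ℤ.* (ℤ.+ d)} (begin
        ζ (c ℤ.* (ℤ.+ b))       ≡⟨ ζ-* c (ℤ.+ b) ⟩
        ζ c * ι b               ≡⟨ cong (_* ι b) xd≡c ⟨
        x * ι d * ι b           ≡⟨ swap x (ι d) (ι b) ⟩
        x * ι b * ι d           ≡⟨ cong (_* ι d) xb≡a ⟩
        ζ a * ι d               ≡⟨ ζ-* a (ℤ.+ d) ⟨
        ζ (a ℤ.* (ℤ.+ d))       ∎)) ⟩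
      ℤ.∣ a ℤ.* (ℤ.+ d) ∣     ≡⟨ ℤₚ.abs-* a (ℤ.+ d) ⟩
      ℤ.∣ a ∣ ℕ.* d           ∎
      where
      open ≡-Reasoning
      swap : ∀ u v w → u * v * w ≡ u * w * v
      swap = solve-∀ ring

    -- If p divided the reduced denominator, equality of the two fractions would make it divide the
    -- product of the reduced numerator and `b`; coprimality excludes the former, `p∤b` the latter.
    integral⇒p∤den : ∀ {x} → Integral p x → p ∤ ↧ₙ x
    integral⇒p∤den {x} (fraction a b p∤b xb≡a) p∣↧x = [ p∤num , p∤b ]′
      (euclidsLemma ℤ.∣ ↥ x ∣ b p-prime
        (subst (p ∣_) (sym (cross-multiply x a b (↥ x) (↧ₙ x) xb≡a (num/den x)))
          (∣n⇒∣m*n ℤ.∣ a ∣ p∣↧x)))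
      where
      p∤num : p ∤ ℤ.∣ ↥ x ∣
      p∤num p∣↥x = p∤1 (subst (_∣ 1) (sym (num-den-coprime x (p∣↥x , p∣↧x))) ∣-refl)

    integral-ζ : ∀ z → Integral p (ζ z)
    integral-ζ z = fraction z 1 p∤1 (ℚₚ.*-identityʳ (ζ z))

    integral-ι : ∀ n → Integral p (ι n)
    integral-ι n = integral-ζ (ℤ.+ n)

    integral-neg : ∀ {x} → Integral p x → Integral p (- x)
    integral-neg {x} (fraction a b p∤b xb≡a) =
      fraction (ℤ.- a) b p∤b
        (trans (sym (ℚₚ.neg-distribˡ-* x (ι b))) (trans (cong -_ xb≡a) (sym (ζ-neg a))))

    integral-* : ∀ {x y} → Integral p x → Integral p y → Integral p (x * y)
    integral-* {x} {y} (fraction a b p∤b xb≡a) (fraction c d p∤d yd≡c) =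
      fraction (a ℤ.* c) (b ℕ.* d) (p∤* p∤b p∤d) (begin
        x * y * ι (b ℕ.* d)        ≡⟨ cong (x * y *_) (ι-* b d) ⟩
        x * y * (ι b * ι d)        ≡⟨ interchange x y (ι b) (ι d) ⟩
        x * ι b * (y * ι d)        ≡⟨ cong₂ _*_ xb≡a yd≡c ⟩
        ζ a * ζ c                  ≡⟨ ζ-* a c ⟨
        ζ (a ℤ.* c)                ∎)
      where
      open ≡-Reasoning
      interchange : ∀ u v w z → u * v * (w * z) ≡ u * w * (v * z)
      interchange = solve-∀ ring

    integral-+ : ∀ {x y} → Integral p x → Integral p y → Integral p (x + y)
    integral-+ {x} {y} (fraction a b p∤b xb≡a) (fraction c d p∤d yd≡c) =
      fraction (a ℤ.* ℤ.+ d ℤ.+ c ℤ.* ℤ.+ b) (b ℕ.* d) (p∤* p∤b p∤d) (begin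
        (x + y) * ι (b ℕ.* d)                    ≡⟨ cong ((x + y) *_) (ι-* b d) ⟩
        (x + y) * (ι b * ι d)                    ≡⟨ expand x y (ι b) (ι d) ⟩
        x * ι b * ι d + y * ι d * ι b            ≡⟨ cong₂ _+_ (cong (_* ι d) xb≡a) (cong (_* ι b) yd≡c) ⟩
        ζ a * ι d + ζ c * ι b                    ≡⟨ cong₂ _+_ (ζ-* a (ℤ.+ d)) (ζ-* c (ℤ.+ b)) ⟨
        ζ (a ℤ.* ℤ.+ d) + ζ (c ℤ.* ℤ.+ b)        ≡⟨ ζ-+ (a ℤ.* ℤ.+ d) (c ℤ.* ℤ.+ b) ⟨
        ζ (a ℤ.* ℤ.+ d ℤ.+ c ℤ.* ℤ.+ b)          ∎)
      where
      open ≡-Reasoning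
      expand : ∀ u v w z → (u + v) * (w * z) ≡ u * w * z + v * z * w
      expand = solve-∀ ring

    integral-pow : ∀ {x} n → Integral p x → Integral p (powℚ x n)
    integral-pow zero    ix = integral-ι 1
    integral-pow (suc n) ix = integral-* ix (integral-pow n ix)

    integral-sgn : ∀ n → Integral p (sgn n)
    integral-sgn n = integral-pow n (integral-neg (integral-ι 1))

    inverse : ∀ x → x ≢ 0ℚ → Σ ℚ λ r → r * x ≡ 1ℚ
    inverse x x≢0 = ℚ.1/ x , ℚₚ.*-inverseˡ x
      where
      instance
        _ : ℚ.NonZero x
        _ = ℚ.≢-nonZero x≢0

    p∤⇒inverse : ∀ {b} → p ∤ b → Σ ℚ λ r → Integral p r × r * ι b ≡ 1ℚ
    p∤⇒inverse {b} p∤b =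
      let r , rb≡1 = inverse (ι b) ιb≢0 in r , fraction (ℤ.+ 1) b p∤b rb≡1 , rb≡1
      where
      ιb≢0 : ι b ≢ 0ℚ
      ιb≢0 ιb≡0 = p∤b (subst (p ∣_) (sym (ℤₚ.+-injective (ζ-injective {ℤ.+ b} {ℤ.+ 0} ιb≡0))) (p ∣0))

    infix 4 _≈[_]_

    record _≈[_]_ (x : ℚ) (m : ℕ) (y : ℚ) : Set where
      constructor congruent
      field
        quotient  : ℚ
        integral  : Integral p quotient
        x-y       : x - y ≡ ι (p ℕ.^ m) * quotient

    ≈⇒mod : ∀ {x y m} → x ≈[ m ] y → x ≡ y [mod p ^ m ]
    ≈⇒mod (congruent c ic eq) = c , integral⇒p∤den ic , eq

    ≈-refl : ∀ {m x} → x ≈[ m ] x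
    ≈-refl {m} {x} = congruent 0ℚ (integral-ι 0)
      (trans (ℚₚ.+-inverseʳ x) (sym (ℚₚ.*-zeroʳ (ι (p ℕ.^ m)))))

    ≈-reflexive : ∀ {m x y} → x ≡ y → x ≈[ m ] y
    ≈-reflexive refl = ≈-refl

    ≈-sym : ∀ {m x y} → x ≈[ m ] y → y ≈[ m ] x
    ≈-sym {m} {x} {y} (congruent c ic eq) = congruent (- c) (integral-neg ic)
      (trans (flip y x) (trans (cong -_ eq) (ℚₚ.neg-distribʳ-* (ι (p ℕ.^ m)) c)))
      where
      flip : ∀ u v → u - v ≡ - (v - u)
      flip = solve-∀ ring

    ≈-+ : ∀ {m x y x′ y′} → x ≈[ m ] y → x′ ≈[ m ] y′ → x + x′ ≈[ m ] y + y′
    ≈-+ {m} {x} {y} {x′} {y′} (congruent c ic eq) (congruent c′ ic′ eq′) =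
      congruent (c + c′) (integral-+ ic ic′)
        (trans (split x y x′ y′)
          (trans (cong₂ _+_ eq eq′) (sym (ℚₚ.*-distribˡ-+ (ι (p ℕ.^ m)) c c′))))
      where
      split : ∀ a b c d → a + c - (b + d) ≡ a - b + (c - d)
      split = solve-∀ ring

    ≈-trans : ∀ {m x y z} → x ≈[ m ] y → y ≈[ m ] z → x ≈[ m ] z
    ≈-trans {m} {x} {y} {z} (congruent c ic eq) (congruent c′ ic′ eq′) =
      congruent (c + c′) (integral-+ ic ic′)
        (trans (insert x y z)
          (trans (cong₂ _+_ eq eq′) (sym (ℚₚ.*-distribˡ-+ (ι (p ℕ.^ m)) c c′))))
      where
      insert : ∀ a b c → a - c ≡ a - b + (b - c)
      insert = solve-∀ ring

    ≈-neg : ∀ {m x y} → x ≈[ m ] y → - x ≈[ m ] - y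
    ≈-neg {m} {x} {y} (congruent c ic eq) = congruent (- c) (integral-neg ic)
      (trans (pull x y) (trans (cong -_ eq) (ℚₚ.neg-distribʳ-* (ι (p ℕ.^ m)) c)))
      where
      pull : ∀ u v → - u - (- v) ≡ - (u - v)
      pull = solve-∀ ring

    ≈-*ˡ : ∀ {m c x y} → Integral p c → x ≈[ m ] y → c * x ≈[ m ] c * y
    ≈-*ˡ {m} {c} {x} {y} ic (congruent q iq eq) = congruent (c * q) (integral-* ic iq)
      (trans (factor c x y) (trans (cong (c *_) eq) (swap c (ι (p ℕ.^ m)) q)))
      where
      factor : ∀ a b c → a * b - a * c ≡ a * (b - c)
      factor = solve-∀ ring
      swap : ∀ a b c → a * (b * c) ≡ b * (a * c)
      swap = solve-∀ ring

    ≈-*ʳ : ∀ {m c x y} → Integral p c → x ≈[ m ] y → x * c ≈[ m ] y * c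
    ≈-*ʳ {m} {c} {x} {y} ic x≈y =
      subst₂ (λ u v → u ≈[ m ] v) (ℚₚ.*-comm c x) (ℚₚ.*-comm c y) (≈-*ˡ ic x≈y)

    ≈-* : ∀ {m x y x′ y′} → Integral p x′ → Integral p y →
          x ≈[ m ] y → x′ ≈[ m ] y′ → x * x′ ≈[ m ] y * y′
    ≈-* ix′ iy x≈y x′≈y′ = ≈-trans (≈-*ʳ ix′ x≈y) (≈-*ˡ iy x′≈y′)

    ≈-pow : ∀ {m x y} n → Integral p x → Integral p y → x ≈[ m ] y → powℚ x n ≈[ m ] powℚ y n
    ≈-pow zero    ix iy x≈y = ≈-refl
    ≈-pow (suc n) ix iy x≈y = ≈-* (integral-pow n ix) iy x≈y (≈-pow n ix iy x≈y)

    ≈-cancel : ∀ {m b x y} → p ∤ b → ι b * x ≈[ m ] ι b * y → x ≈[ m ] y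
    ≈-cancel {m} {b} {x} {y} p∤b bx≈by =
      let r , ir , rb≡1 = p∤⇒inverse p∤b
          unit z = trans (sym (ℚₚ.*-assoc r (ι b) z)) (trans (cong (_* z) rb≡1) (ℚₚ.*-identityˡ z))
      in subst₂ (λ u v → u ≈[ m ] v) (unit x) (unit y) (≈-*ˡ ir bx≈by)

    -- Feeds facts modulo p, such as Fermat's theorem, into congruences modulo p³ once a factor p²
    -- stands in front.
    ≈-scale : ∀ k {m x y} → x ≈[ m ] y → ι (p ℕ.^ k) * x ≈[ k ℕ.+ m ] ι (p ℕ.^ k) * y
    ≈-scale k {m} {x} {y} (congruent c ic eq) = congruent c ic (begin
      ι (p ℕ.^ k) * x - ι (p ℕ.^ k) * y     ≡⟨ factor (ι (p ℕ.^ k)) x y ⟩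
      ι (p ℕ.^ k) * (x - y)                 ≡⟨ cong (ι (p ℕ.^ k) *_) eq ⟩
      ι (p ℕ.^ k) * (ι (p ℕ.^ m) * c)       ≡⟨ ℚₚ.*-assoc (ι (p ℕ.^ k)) (ι (p ℕ.^ m)) c ⟨
      ι (p ℕ.^ k) * ι (p ℕ.^ m) * c         ≡⟨ cong (_* c) (trans (cong ι (ℕₚ.^-distribˡ-+-* p k m)) (ι-* (p ℕ.^ k) (p ℕ.^ m))) ⟨
      ι (p ℕ.^ (k ℕ.+ m)) * c               ∎)
      where
      open ≡-Reasoning
      factor : ∀ a b c → a * b - a * c ≡ a * (b - c)
      factor = solve-∀ ring

    ≈-weaken : ∀ k {m x y} → x ≈[ k ℕ.+ m ] y → x ≈[ m ] y
    ≈-weaken k {m} {x} {y} (congruent c ic eq) =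
      congruent (ι (p ℕ.^ k) * c) (integral-* (integral-ι (p ℕ.^ k)) ic) (begin
        x - y                                 ≡⟨ eq ⟩
        ι (p ℕ.^ (k ℕ.+ m)) * c               ≡⟨ cong (_* c) (trans (cong ι (ℕₚ.^-distribˡ-+-* p k m)) (ι-* (p ℕ.^ k) (p ℕ.^ m))) ⟩
        ι (p ℕ.^ k) * ι (p ℕ.^ m) * c         ≡⟨ swap (ι (p ℕ.^ k)) (ι (p ℕ.^ m)) c ⟩
        ι (p ℕ.^ m) * (ι (p ℕ.^ k) * c)       ∎)
      where
      open ≡-Reasoning
      swap : ∀ a b c → a * b * c ≡ b * (a * c)
      swap = solve-∀ ring

    p^m≈0 : ∀ m {c} → Integral p c → ι (p ℕ.^ m) * c ≈[ m ] 0ℚ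
    p^m≈0 m {c} ic = congruent c ic (ℚₚ.+-identityʳ (ι (p ℕ.^ m) * c))

    p≈0 : ι p ≈[ 1 ] 0ℚ
    p≈0 = subst (λ u → u ≈[ 1 ] 0ℚ)
      (trans (ℚₚ.*-identityʳ (ι (p ℕ.^ 1))) (cong ι (ℕₚ.^-identityʳ p)))
      (p^m≈0 1 (integral-ι 1))

    p∣⇒≈0 : ∀ {n} → p ∣ n → ι n ≈[ 1 ] 0ℚ
    p∣⇒≈0 (divides q refl) = subst₂ (λ u v → u ≈[ 1 ] v)
      (sym (ι-* q p)) (ℚₚ.*-zeroʳ (ι q)) (≈-*ˡ (integral-ι q) p≈0)

    -- Clearing the denominator b of the quotient gives n b = ±a p, and Euclid's lemma makes p
    -- divide n.
    ≈0⇒p∣ : ∀ {n} → ι n ≈[ 1 ] 0ℚ → p ∣ n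
    ≈0⇒p∣ {n} (congruent c (fraction a b p∤b cb≡a) eq) =
      [ (λ p∣n → p∣n) , (λ p∣b → contradiction p∣b p∤b) ]′
        (euclidsLemma n b p-prime (divides ℤ.∣ a ∣ nb≡ap))
      where
      open ≡-Reasoning
      drop0 : ∀ u → u ≡ u - 0ℚ
      drop0 = solve-∀ ring
      shuffle : ∀ u v w → u * v * w ≡ v * w * u
      shuffle = solve-∀ ring
      nb≡ap : n ℕ.* b ≡ ℤ.∣ a ∣ ℕ.* p
      nb≡ap = trans (cong ℤ.∣_∣ (ζ-injective {ℤ.+ (n ℕ.* b)} {a ℤ.* ℤ.+ p} (begin
        ι (n ℕ.* b)               ≡⟨ ι-* n b ⟩
        ι n * ι b                 ≡⟨ cong (_* ι b) (trans (drop0 (ι n)) eq) ⟩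
        ι (p ℕ.^ 1) * c * ι b     ≡⟨ cong (λ k → ι k * c * ι b) (ℕₚ.^-identityʳ p) ⟩
        ι p * c * ι b             ≡⟨ shuffle (ι p) c (ι b) ⟩
        c * ι b * ι p             ≡⟨ cong (_* ι p) cb≡a ⟩
        ζ a * ι p                 ≡⟨ ζ-* a (ℤ.+ p) ⟨
        ζ (a ℤ.* ℤ.+ p)           ∎))) (ℤₚ.abs-* a (ℤ.+ p))

    ≈-setoid : ℕ → Setoid 0ℓ 0ℓ
    ≈-setoid m = record
      { Carrier = ℚ
      ; _≈_ = _≈[ m ]_
      ; isEquivalence = record { refl = ≈-refl ; sym = ≈-sym ; trans = ≈-trans }
      }

  -- Binomial coefficients and the exact difference identity

  Pascal : ∀ n k → ι (suc n C suc k) ≡ ι (n C k) + ι (n C suc k)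
  Pascal n k = trans (cong ι (sym (nCk+nC[k+1]≡[n+1]C[k+1] n k))) (ι-+ (n C k) (n C suc k))

  absorption : ∀ n k → suc k ℕ.* (suc n C suc k) ≡ suc n ℕ.* (n C k)
  absorption zero    zero    = refl
  absorption zero    (suc k) = ℕₚ.*-zeroʳ (suc (suc k))
  absorption (suc n) zero    = trans (ℕₚ.*-identityˡ _) (trans (nC1≡n (suc (suc n))) (sym (ℕₚ.*-identityʳ (suc (suc n)))))
  absorption (suc n) (suc k) = begin
    suc (suc k) ℕ.* (suc (suc n) C suc (suc k))                            ≡⟨ cong (suc (suc k) ℕ.*_) (nCk+nC[k+1]≡[n+1]C[k+1] (suc n) (suc k)) ⟨
    suc (suc k) ℕ.* ((suc n C suc k) ℕ.+ (suc n C suc (suc k)))            ≡⟨ spread (suc k) (suc n C suc k) (suc n C suc (suc k)) ⟩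
    (suc n C suc k) ℕ.+ (suc k ℕ.* (suc n C suc k) ℕ.+ suc (suc k) ℕ.* (suc n C suc (suc k)))
      ≡⟨ cong ((suc n C suc k) ℕ.+_) (cong₂ ℕ._+_ (absorption n k) (absorption n (suc k))) ⟩
    (suc n C suc k) ℕ.+ (suc n ℕ.* (n C k) ℕ.+ suc n ℕ.* (n C suc k))      ≡⟨ cong ((suc n C suc k) ℕ.+_) (ℕₚ.*-distribˡ-+ (suc n) (n C k) (n C suc k)) ⟨
    (suc n C suc k) ℕ.+ suc n ℕ.* ((n C k) ℕ.+ (n C suc k))                ≡⟨ cong (λ c → (suc n C suc k) ℕ.+ suc n ℕ.* c) (nCk+nC[k+1]≡[n+1]C[k+1] n k) ⟩
    suc (suc n) ℕ.* (suc n C suc k)                                        ∎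
    where
    open ≡-Reasoning
    spread : ∀ j a b → suc j ℕ.* (a ℕ.+ b) ≡ a ℕ.+ (j ℕ.* a ℕ.+ suc j ℕ.* b)
    spread = ℕ-RingSolver.solve-∀

  absorptionℚ : ∀ n k → ι (suc k) * ι (suc n C suc k) ≡ ι (suc n) * ι (n C k)
  absorptionℚ n k = trans (sym (ι-* (suc k) (suc n C suc k)))
    (trans (cong ι (absorption n k)) (ι-* (suc n) (n C k)))

  -- Pascal's rule minus absorption. The subtraction is taken in ℚ, so that no bound on `k` has to
  -- be carried along.
  C-raise : ∀ n k → (ι (suc n) - ι k) * ι (suc n C k) ≡ ι (suc n) * ι (n C k)
  C-raise n zero    = cong (_* 1ℚ) (ℚₚ.+-identityʳ (ι (suc n)))
  C-raise n (suc k) = begin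
    (ι (suc n) - ι (suc k)) * ι (suc n C suc k)                       ≡⟨ expand (ι (suc n)) (ι (suc k)) (ι (suc n C suc k)) ⟩
    ι (suc n) * ι (suc n C suc k) - ι (suc k) * ι (suc n C suc k)     ≡⟨ cong₂ (λ u v → ι (suc n) * u - v) (Pascal n k) (absorptionℚ n k) ⟩
    ι (suc n) * (ι (n C k) + ι (n C suc k)) - ι (suc n) * ι (n C k)   ≡⟨ isolate (ι (suc n)) (ι (n C k)) (ι (n C suc k)) ⟨
    ι (suc n) * ι (n C suc k)                                         ∎
    where
    open ≡-Reasoning
    isolate : ∀ s a b → s * b ≡ s * (a + b) - s * a
    isolate = solve-∀ ring
    expand : ∀ a b c → (a - b) * c ≡ a * c - b * c
    expand = solve-∀ ring

  2*suc : ∀ n → 2 ℕ.* suc n ≡ suc (suc (2 ℕ.* n))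
  2*suc = ℕ-RingSolver.solve-∀

  central : ℕ → ℚ
  central k = ι ((2 ℕ.* k) C k)

  central-suc : ∀ n → ι (suc n) * central (suc n) ≡ ι 2 * ι (suc (2 ℕ.* n)) * central n
  central-suc n = begin
    ι (suc n) * central (suc n)                           ≡⟨ cong (λ m → ι (suc n) * ι (m C suc n)) (2*suc n) ⟩
    ι (suc n) * ι (suc (suc (2 ℕ.* n)) C suc n)           ≡⟨ absorptionℚ (suc (2 ℕ.* n)) n ⟩
    ι (suc (suc (2 ℕ.* n))) * ι (suc (2 ℕ.* n) C n)       ≡⟨ cong (_* ι (suc (2 ℕ.* n) C n)) (trans (cong ι (sym (2*suc n))) (ι-* 2 (suc n))) ⟩
    ι 2 * ι (suc n) * ι (suc (2 ℕ.* n) C n)               ≡⟨ ℚₚ.*-assoc (ι 2) (ι (suc n)) (ι (suc (2 ℕ.* n) C n)) ⟩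
    -- n + 1 is read as (2n+1) - n, the factor that `C-raise` absorbs.
    ι 2 * (ι (suc n) * ι (suc (2 ℕ.* n) C n))             ≡⟨ cong (λ u → ι 2 * (u * ι (suc (2 ℕ.* n) C n))) (trans (cong ι (sym half)) (ι-∸ n≤)) ⟩
    ι 2 * ((ι (suc (2 ℕ.* n)) - ι n) * ι (suc (2 ℕ.* n) C n)) ≡⟨ cong (ι 2 *_) (C-raise (2 ℕ.* n) n) ⟩
    ι 2 * (ι (suc (2 ℕ.* n)) * central n)                 ≡⟨ ℚₚ.*-assoc (ι 2) (ι (suc (2 ℕ.* n))) (central n) ⟨
    ι 2 * ι (suc (2 ℕ.* n)) * central n                   ∎
    where
    open ≡-Reasoning
    split : ∀ n → suc (2 ℕ.* n) ≡ n ℕ.+ suc n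
    split = ℕ-RingSolver.solve-∀
    n≤ : n ℕ.≤ suc (2 ℕ.* n)
    n≤ = subst (n ℕ.≤_) (sym (split n)) (ℕₚ.m≤m+n n (suc n))
    half : suc (2 ℕ.* n) ℕ.∸ n ≡ suc n
    half = trans (cong (ℕ._∸ n) (split n)) (ℕₚ.m+n∸m≡n n (suc n))

  1/16 : ℚ
  1/16 = (ℤ.+ 1) ℚ./ 16

  summand : ℕ → ℕ → ℚ
  summand d k = ι (((2 ℕ.* k) C k) ℕ.* ((2 ℕ.* k) C (k ℕ.+ d))) * powℚ 1/16 k

  summand-split : ∀ d k → summand d k ≡ central k * ι ((2 ℕ.* k) C (k ℕ.+ d)) * powℚ 1/16 k
  summand-split d k = cong (_* powℚ 1/16 k) (ι-* ((2 ℕ.* k) C k) ((2 ℕ.* k) C (k ℕ.+ d)))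

  -- A closed form for 2d+1 times the difference of the sums up to N at d and d+1. At N = n its
  -- first factor is p and its second binomial is C(p,n+d+1), another multiple of p for d < n.
  boundary : ℕ → ℕ → ℚ
  boundary d N = ι (suc (2 ℕ.* N)) * central N * ι (suc (2 ℕ.* N) C suc (N ℕ.+ d)) * powℚ 1/16 N

  -- Both (M - d) C(2M, M+d) and (M + d + 1) C(2M, M+d+1) equal 2M C(2M-1, M+d); adding them
  -- gives the increment of the boundary term.
  boundary-suc : ∀ d N → boundary d N + ι (suc (2 ℕ.* d)) * (summand d (suc N) - summand (suc d) (suc N))
               ≡ boundary d (suc N)
  boundary-suc d N = begin
    w * a * b * q + e * (summand d M - summand (suc d) M)
      ≡⟨ cong (λ u → w * a * b * q + e * u) (cong₂ _-_ split₁ split₂) ⟩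
    w * a * b * q + e * (a′ * x * (1/16 * q) - a′ * y * (1/16 * q))
      -- 16 is split as 8 · 2, where the 2 completes the right side of `central-suc`.
      ≡⟨ regroup w a b q e a′ x y ⟩
    1/16 * q * (ι 8 * (ι 2 * w * a) * b + e * a′ * (x - y))
      ≡⟨ cong (λ u → 1/16 * q * (ι 8 * u * b + e * a′ * (x - y))) (central-suc N) ⟨
    1/16 * q * (ι 8 * (ι M * a′) * b + e * a′ * (x - y))
      -- 8 M b becomes two copies of 2 (2 M b), one for each of `eq₁` and `eq₂`.
      ≡⟨ halve q (ι M) a′ b e x y ⟩
    1/16 * q * a′ * (ι 2 * (ι 2 * ι M * b) + ι 2 * (ι 2 * ι M * b) + e * (x - y))
      ≡⟨ cong (λ u → 1/16 * q * a′ * (u + e * (x - y))) (cong₂ (λ u v → ι 2 * u + ι 2 * v) eq₁ eq₂) ⟨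
    1/16 * q * a′ * (ι 2 * ((ι M - ι d) * x) + ι 2 * ((1ℚ + (ι M + ι d)) * y) + e * (x - y))
      ≡⟨ cong (λ u → 1/16 * q * a′ * (ι 2 * ((ι M - ι d) * x) + ι 2 * ((1ℚ + (ι M + ι d)) * y) + u * (x - y))) (odd d) ⟩
    1/16 * q * a′ * (ι 2 * ((ι M - ι d) * x) + ι 2 * ((1ℚ + (ι M + ι d)) * y) + (1ℚ + ι 2 * ι d) * (x - y))
      -- The terms in d cancel: x and y both get the coefficient 2M + 1, and Pascal's rule then
      -- merges x + y.
      ≡⟨ finish q a′ (ι M) (ι d) x y ⟩
    (1ℚ + ι 2 * ι M) * a′ * (x + y) * (1/16 * q)
      ≡⟨ cong₂ (λ u v → u * a′ * v * (1/16 * q)) (odd M) (Pascal (2 ℕ.* M) (M ℕ.+ d)) ⟨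
    boundary d M ∎
    where
    open ≡-Reasoning
    M = suc N
    w = ι (suc (2 ℕ.* N))
    a = central N
    a′ = central M
    b = ι (suc (2 ℕ.* N) C suc (N ℕ.+ d))
    q = powℚ 1/16 N
    e = ι (suc (2 ℕ.* d))
    x = ι ((2 ℕ.* M) C (M ℕ.+ d))
    y = ι ((2 ℕ.* M) C suc (M ℕ.+ d))
    odd : ∀ n → ι (suc (2 ℕ.* n)) ≡ 1ℚ + ι 2 * ι n
    odd n = trans (ι-suc (2 ℕ.* n)) (cong (1ℚ +_) (ι-* 2 n))
    split₁ : summand d M ≡ a′ * x * (1/16 * q)
    split₁ = summand-split d M
    split₂ : summand (suc d) M ≡ a′ * y * (1/16 * q)
    split₂ = trans (summand-split (suc d) M) (cong (λ j → a′ * ι ((2 ℕ.* M) C j) * (1/16 * q)) (ℕₚ.+-suc M d))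
    2M : ι (suc (suc (2 ℕ.* N))) ≡ ι 2 * ι M
    2M = trans (cong ι (sym (2*suc N))) (ι-* 2 M)
    M-d : ∀ m d → ι 2 * m - (m + d) ≡ m - d
    M-d = solve-∀ ring
    eq₁ : (ι M - ι d) * x ≡ ι 2 * ι M * b
    eq₁ = begin
      (ι M - ι d) * x                                                   ≡⟨ cong (_* x) (M-d (ι M) (ι d)) ⟨
      (ι 2 * ι M - (ι M + ι d)) * x                                     ≡⟨ cong₂ (λ u v → (u - v) * x) 2M (ι-+ M d) ⟨
      (ι (suc (suc (2 ℕ.* N))) - ι (M ℕ.+ d)) * x                       ≡⟨ cong (λ m → (ι (suc (suc (2 ℕ.* N))) - ι (M ℕ.+ d)) * ι (m C (M ℕ.+ d))) (2*suc N) ⟩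
      (ι (suc (suc (2 ℕ.* N))) - ι (M ℕ.+ d)) * ι (suc (suc (2 ℕ.* N)) C (M ℕ.+ d)) ≡⟨ C-raise (suc (2 ℕ.* N)) (M ℕ.+ d) ⟩
      ι (suc (suc (2 ℕ.* N))) * b                                       ≡⟨ cong (_* b) 2M ⟩
      ι 2 * ι M * b                                                     ∎
    eq₂ : (1ℚ + (ι M + ι d)) * y ≡ ι 2 * ι M * b
    eq₂ = begin
      (1ℚ + (ι M + ι d)) * y                                            ≡⟨ cong (_* y) (trans (ι-suc (M ℕ.+ d)) (cong (1ℚ +_) (ι-+ M d))) ⟨
      ι (suc (M ℕ.+ d)) * y                                             ≡⟨ cong (λ m → ι (suc (M ℕ.+ d)) * ι (m C suc (M ℕ.+ d))) (2*suc N) ⟩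
      ι (suc (M ℕ.+ d)) * ι (suc (suc (2 ℕ.* N)) C suc (M ℕ.+ d))       ≡⟨ absorptionℚ (suc (2 ℕ.* N)) (M ℕ.+ d) ⟩
      ι (suc (suc (2 ℕ.* N))) * b                                       ≡⟨ cong (_* b) 2M ⟩
      ι 2 * ι M * b                                                     ∎
    regroup : ∀ w a b q e a′ x y → w * a * b * q + e * (a′ * x * (1/16 * q) - a′ * y * (1/16 * q))
            ≡ 1/16 * q * (ι 8 * (ι 2 * w * a) * b + e * a′ * (x - y))
    regroup = solve-∀ ring
    halve : ∀ q m a′ b e x y → 1/16 * q * (ι 8 * (m * a′) * b + e * a′ * (x - y))
          ≡ 1/16 * q * a′ * (ι 2 * (ι 2 * m * b) + ι 2 * (ι 2 * m * b) + e * (x - y))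
    halve = solve-∀ ring
    finish : ∀ q a′ m d x y → 1/16 * q * a′ * (ι 2 * ((m - d) * x) + ι 2 * ((1ℚ + (m + d)) * y) + (1ℚ + ι 2 * d) * (x - y))
           ≡ (1ℚ + ι 2 * m) * a′ * (x + y) * (1/16 * q)
    finish = solve-∀ ring

  sum-difference : ∀ d N → ι (suc (2 ℕ.* d)) * (sumTo N (summand d) - sumTo N (summand (suc d))) ≡ boundary d N
  -- At N = 0 the boundary is C(1,d+1), which is 1 for d = 0 and 0 otherwise.
  sum-difference zero    zero = refl
  sum-difference (suc d) zero = ℚₚ.*-zeroʳ (ι (suc (2 ℕ.* suc d)))
  sum-difference d (suc N) = begin
    e * (s + t - (s′ + t′))              ≡⟨ split e s t s′ t′ ⟩
    e * (s - s′) + e * (t - t′)          ≡⟨ cong (_+ e * (t - t′)) (sum-difference d N) ⟩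
    boundary d N + e * (t - t′)          ≡⟨ boundary-suc d N ⟩
    boundary d (suc N)                   ∎
    where
    open ≡-Reasoning
    e = ι (suc (2 ℕ.* d))
    s = sumTo N (summand d)
    s′ = sumTo N (summand (suc d))
    t = summand d (suc N)
    t′ = summand (suc d) (suc N)
    split : ∀ e s t s′ t′ → e * (s + t - (s′ + t′)) ≡ e * (s - s′) + e * (t - t′)
    split = solve-∀ ring

  sumTo-last : ∀ n (f : ℕ → ℚ) → (∀ k → k ℕ.< n → f k ≡ 0ℚ) → sumTo n f ≡ f n
  sumTo-last zero    f f≡0 = refl
  sumTo-last (suc n) f f≡0 = trans
    (cong (_+ f (suc n)) (trans (sumTo-last n f (λ k k<n → f≡0 k (ℕₚ.m≤n⇒m≤1+n k<n))) (f≡0 n ℕₚ.≤-refl)))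
    (ℚₚ.+-identityˡ (f (suc n)))

  -- For k < n the lower index of C(2k,k+n) exceeds 2k, so only k = n contributes.
  sum-summand-top : ∀ n → sumTo n (summand n) ≡ central n * powℚ 1/16 n
  sum-summand-top n = trans (sumTo-last n (summand n) vanish) (begin
    summand n n                                                 ≡⟨ summand-split n n ⟩
    central n * ι ((2 ℕ.* n) C (n ℕ.+ n)) * powℚ 1/16 n         ≡⟨ cong (λ c → central n * ι c * powℚ 1/16 n) (trans (cong (λ m → (2 ℕ.* n) C (n ℕ.+ m)) (sym (ℕₚ.+-identityʳ n))) (nCn≡1 (2 ℕ.* n))) ⟩
    central n * 1ℚ * powℚ 1/16 n                                ≡⟨ cong (_* powℚ 1/16 n) (ℚₚ.*-identityʳ (central n)) ⟩
    central n * powℚ 1/16 n                                     ∎)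
    where
    open ≡-Reasoning
    vanish : ∀ k → k ℕ.< n → summand n k ≡ 0ℚ
    vanish k k<n = begin
      summand n k                                               ≡⟨ summand-split n k ⟩
      central k * ι ((2 ℕ.* k) C (k ℕ.+ n)) * powℚ 1/16 k       ≡⟨ cong (λ c → central k * ι c * powℚ 1/16 k) (k>n⇒nCk≡0 2k<k+n) ⟩
      central k * 0ℚ * powℚ 1/16 k                              ≡⟨ cong (_* powℚ 1/16 k) (ℚₚ.*-zeroʳ (central k)) ⟩
      0ℚ * powℚ 1/16 k                                          ≡⟨ ℚₚ.*-zeroˡ (powℚ 1/16 k) ⟩
      0ℚ                                                        ∎
      where
      2k<k+n : 2 ℕ.* k ℕ.< k ℕ.+ n
      2k<k+n = ℕₚ.+-monoʳ-< k (subst (ℕ._< n) (sym (ℕₚ.+-identityʳ k)) k<n)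

  -- Binomial transform and Euler polynomials

  -- The binomial transform (bt-sum), i.e. multiplication of exponential generating functions by eᵗ.
  bt : (ℕ → ℚ) → ℕ → ℚ
  bt a zero    = a 0
  bt a (suc n) = bt a n + bt (a ∘ suc) n

  bt-cong : ∀ n {a b : ℕ → ℚ} → (∀ k → a k ≡ b k) → bt a n ≡ bt b n
  bt-cong zero    a≗b = a≗b 0
  bt-cong (suc n) a≗b = cong₂ _+_ (bt-cong n a≗b) (bt-cong n (λ k → a≗b (suc k)))

  bt-+ : ∀ n (a b : ℕ → ℚ) → bt (λ k → a k + b k) n ≡ bt a n + bt b n
  bt-+ zero    a b = refl
  bt-+ (suc n) a b = trans (cong₂ _+_ (bt-+ n a b) (bt-+ n (a ∘ suc) (b ∘ suc)))
    (interchange (bt a n) (bt b n) (bt (a ∘ suc) n) (bt (b ∘ suc) n))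
    where
    interchange : ∀ a b c d → a + b + (c + d) ≡ a + c + (b + d)
    interchange = solve-∀ ring

  bt-* : ∀ n c (a : ℕ → ℚ) → bt (λ k → c * a k) n ≡ c * bt a n
  bt-* zero    c a = refl
  bt-* (suc n) c a = trans (cong₂ _+_ (bt-* n c a) (bt-* n c (a ∘ suc)))
    (sym (ℚₚ.*-distribˡ-+ c (bt a n) (bt (a ∘ suc) n)))

  bt-pow : ∀ n x → bt (powℚ x) n ≡ powℚ (1ℚ + x) n
  bt-pow zero    x = refl
  bt-pow (suc n) x = trans
    (cong₂ _+_ (bt-pow n x) (trans (bt-* n x (powℚ x)) (cong (x *_) (bt-pow n x))))
    (collect x (powℚ (1ℚ + x) n))
    where
    collect : ∀ x a → a + x * a ≡ (1ℚ + x) * a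
    collect = solve-∀ ring

  bt-sum : ∀ n (a : ℕ → ℚ) → bt a n ≡ sumTo n (λ k → ι (n C k) * a k)
  bt-sum zero    a = sym (ℚₚ.*-identityˡ (a 0))
  bt-sum (suc n) a = begin
    bt a n + bt (a ∘ suc) n                            ≡⟨ cong₂ _+_ (bt-sum n a) (bt-sum n (a ∘ suc)) ⟩
    sumTo n f + t                                      ≡⟨ cong (_+ t) extend ⟨
    sumTo (suc n) f + t                                ≡⟨ cong (_+ t) (sumTo-suc n f) ⟩
    f 0 + sumTo n (f ∘ suc) + t                        ≡⟨ rotate (f 0) (sumTo n (f ∘ suc)) t ⟩
    f 0 + (t + sumTo n (f ∘ suc))                      ≡⟨ cong (λ u → f 0 + u) (sumTo-+ n (λ k → ι (n C k) * a (suc k)) (f ∘ suc)) ⟨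
    f 0 + sumTo n (λ k → ι (n C k) * a (suc k) + f (suc k)) ≡⟨ cong (λ u → f 0 + u) (sumTo-cong n merge) ⟩
    f 0 + sumTo n (λ k → ι (suc n C suc k) * a (suc k))     ≡⟨ sumTo-suc n (λ k → ι (suc n C k) * a k) ⟨
    sumTo (suc n) (λ k → ι (suc n C k) * a k)          ∎
    where
    open ≡-Reasoning
    f : ℕ → ℚ
    f k = ι (n C k) * a k
    t : ℚ
    t = sumTo n (λ k → ι (n C k) * a (suc k))
    extend : sumTo (suc n) f ≡ sumTo n f
    extend = trans
      (cong (λ c → sumTo n f + ι c * a (suc n)) (k>n⇒nCk≡0 (ℕₚ.n<1+n n)))
      (trans (cong (λ u → sumTo n f + u) (ℚₚ.*-zeroˡ (a (suc n)))) (ℚₚ.+-identityʳ (sumTo n f)))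
    rotate : ∀ a b c → a + b + c ≡ a + (c + b)
    rotate = solve-∀ ring
    merge : ∀ k → ι (n C k) * a (suc k) + f (suc k) ≡ ι (suc n C suc k) * a (suc k)
    merge k = trans (sym (ℚₚ.*-distribʳ-+ (a (suc k)) (ι (n C k)) (ι (n C suc k))))
      (cong (_* a (suc k)) (sym (Pascal n k)))

  -- In exponential generating functions: A(t) becomes eᵗ A(t), the signs turn this into e^(-t)
  -- A(-t), and the outer transform leaves A(-t).
  bt-sgn-bt : ∀ n (a : ℕ → ℚ) → bt (λ k → sgn k * bt a k) n ≡ sgn n * a n
  bt-sgn-bt zero    a = refl
  bt-sgn-bt (suc n) a = begin
    bt b n + bt (λ k → sgn (suc k) * (bt a k + bt (a ∘ suc) k)) n
      ≡⟨ cong (λ u → bt b n + u) (bt-cong n (λ k → expand (sgn k) (bt a k) (bt (a ∘ suc) k))) ⟩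
    bt b n + bt (λ k → - 1ℚ * (b k + b′ k)) n
      ≡⟨ cong (λ u → bt b n + u) (trans (bt-* n (- 1ℚ) (λ k → b k + b′ k)) (cong (λ u → - 1ℚ * u) (bt-+ n b b′))) ⟩
    bt b n + - 1ℚ * (bt b n + bt b′ n)
      ≡⟨ cancel (bt b n) (bt b′ n) ⟩
    - 1ℚ * bt b′ n
      ≡⟨ cong (λ u → - 1ℚ * u) (bt-sgn-bt n (a ∘ suc)) ⟩
    - 1ℚ * (sgn n * a (suc n))
      ≡⟨ ℚₚ.*-assoc (- 1ℚ) (sgn n) (a (suc n)) ⟨
    sgn (suc n) * a (suc n) ∎
    where
    open ≡-Reasoning
    b b′ : ℕ → ℚ
    b k = sgn k * bt a k
    b′ k = sgn k * bt (a ∘ suc) k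
    expand : ∀ s u v → - 1ℚ * s * (u + v) ≡ - 1ℚ * (s * u + s * v)
    expand = solve-∀ ring
    cancel : ∀ u v → u + - 1ℚ * (u + v) ≡ - 1ℚ * v
    cancel = solve-∀ ring

  -- A top-level copy of the local function of `eulerList`, so that facts about it can be stated.
  rowSum : ℕ → ℕ → List ℚ → ℚ
  rowSum m j       []       = 0ℚ
  rowSum m zero    (e ∷ es) = ι (m C 0) * e
  rowSum m (suc j) (e ∷ es) = ι (m C suc j) * e + rowSum m j es

  -- The local function of eulerList cannot be named from outside: the placeholder in the type of
  -- go≡rowSum is solved to it, by unification at the call in step, once step has turned its
  -- arguments into distinct variables.
  mutual
    eulerPoly-suc-suc : ∀ n x → eulerPoly (suc (suc n)) x ≡
      powℚ x (suc (suc n)) - ½ * rowSum (suc (suc n)) (suc n) (eulerList (suc n) x)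
    eulerPoly-suc-suc n x = cong
      (λ s → powℚ x (suc (suc n)) - ½ * (ι (suc (suc n) C suc n) * eulerPoly (suc n) x + s)) (step n x)

    step : ∀ n x → _ ≡ rowSum (suc (suc n)) n (eulerList n x)
    step n x with suc n | eulerList n x
    ... | k | es with suc k
    ... | m = go≡rowSum k x m n es

    go≡rowSum : ∀ k x m j es → _ ≡ rowSum m j es
    go≡rowSum k x m j       []       = refl
    go≡rowSum k x m zero    (e ∷ es) = refl
    go≡rowSum k x m (suc j) (e ∷ es) = cong (λ s → ι (m C suc j) * e + s) (go≡rowSum k x m j es)

  -- The index comes last, which makes `E x` a sequence on which `bt` can act.
  E : ℚ → ℕ → ℚ
  E x n = eulerPoly n x

  rowSum-eulerList : ∀ m j x → rowSum m j (eulerList j x) ≡ sumTo j (λ k → ι (m C k) * E x k)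
  rowSum-eulerList m zero    x = refl
  rowSum-eulerList m (suc j) x = trans
    (cong (λ s → ι (m C suc j) * E x (suc j) + s) (rowSum-eulerList m j x))
    (ℚₚ.+-comm (ι (m C suc j) * E x (suc j)) (sumTo j (λ k → ι (m C k) * E x k)))

  eulerPoly-suc : ∀ n x → E x (suc n) ≡ powℚ x (suc n) - ½ * sumTo n (λ k → ι (suc n C k) * E x k)
  eulerPoly-suc zero    x = refl
  eulerPoly-suc (suc n) x = trans (eulerPoly-suc-suc n x)
    (cong (λ s → powℚ x (suc (suc n)) - ½ * s) (rowSum-eulerList (suc (suc n)) (suc n) x))

  -- The coefficient of tⁿ/n! in (eᵗ + 1) Σ Eₙ(x) tⁿ/n! = 2 eˣᵗ.
  euler-bt : ∀ x n → E x n + bt (E x) n ≡ ι 2 * powℚ x n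
  euler-bt x zero    = refl
  euler-bt x (suc n) = begin
    E x (suc n) + bt (E x) (suc n)                                 ≡⟨ cong (λ u → E x (suc n) + u) (bt-sum (suc n) (E x)) ⟩
    E x (suc n) + (r + ι (suc n C suc n) * E x (suc n))            ≡⟨ cong (λ c → E x (suc n) + (r + ι c * E x (suc n))) (nCn≡1 (suc n)) ⟩
    E x (suc n) + (r + 1ℚ * E x (suc n))                           ≡⟨ cong (λ e → e + (r + 1ℚ * e)) (eulerPoly-suc n x) ⟩
    powℚ x (suc n) - ½ * r + (r + 1ℚ * (powℚ x (suc n) - ½ * r))   ≡⟨ simplify (powℚ x (suc n)) r ⟩
    ι 2 * powℚ x (suc n)                                           ∎
    where
    open ≡-Reasoning
    r : ℚ
    r = sumTo n (λ k → ι (suc n C k) * E x k)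
    simplify : ∀ q r → q - ½ * r + (r + 1ℚ * (q - ½ * r)) ≡ ι 2 * q
    simplify = solve-∀ ring

  -- Finite differences, sums and factorials

  Δ^ : ℕ → (ℕ → ℚ) → ℕ → ℚ
  Δ^ zero    f x = f x
  Δ^ (suc m) f x = Δ^ m f (suc x) - Δ^ m f x

  Δ^-shift : ∀ m (f : ℕ → ℚ) x → Δ^ m f (suc x) ≡ Δ^ m (f ∘ suc) x
  Δ^-shift zero    f x = refl
  Δ^-shift (suc m) f x = cong₂ _-_ (Δ^-shift m f (suc x)) (Δ^-shift m f x)

  Δ^-const : ∀ m c x → Δ^ (suc m) (λ _ → c) x ≡ 0ℚ
  Δ^-const zero    c x = ℚₚ.+-inverseʳ c
  Δ^-const (suc m) c x = cong₂ _-_ (Δ^-const m c (suc x)) (Δ^-const m c x)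

  -- The factor y has first difference 1 and vanishing higher ones, so the product rule keeps only
  -- two terms.
  Δ^-Leibniz : ∀ m (f : ℕ → ℚ) x →
    Δ^ (suc m) (λ y → ι y * f y) x ≡ ι x * Δ^ (suc m) f x + ι (suc m) * Δ^ m f (suc x)
  Δ^-Leibniz zero    f x = trans (cong (λ u → u * f (suc x) - ι x * f x) (ι-suc x)) (expand (ι x) (f (suc x)) (f x))
    where
    expand : ∀ x a b → (1ℚ + x) * a - x * b ≡ x * (a - b) + ι 1 * a
    expand = solve-∀ ring
  Δ^-Leibniz (suc m) f x = begin
    Δ^ (suc m) (λ y → ι y * f y) (suc x) - Δ^ (suc m) (λ y → ι y * f y) x
      ≡⟨ cong₂ _-_ (Δ^-Leibniz m f (suc x)) (Δ^-Leibniz m f x) ⟩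
    ι (suc x) * a + μ * c₂ - (ι x * b + μ * c₁)
      ≡⟨ cong (λ u → u * a + μ * c₂ - (ι x * b + μ * c₁)) (ι-suc x) ⟩
    (1ℚ + ι x) * a + μ * c₂ - (ι x * b + μ * c₁)
      ≡⟨ regroup (ι x) μ a b c₁ c₂ ⟩
    ι x * (a - b) + (a + μ * (c₂ - c₁))
      ≡⟨ cong (λ u → ι x * (a - b) + u) (collect μ a) ⟩
    ι x * (a - b) + (1ℚ + μ) * a
      ≡⟨ cong (λ u → ι x * (a - b) + u * a) (ι-suc (suc m)) ⟨
    ι x * (a - b) + ι (suc (suc m)) * a ∎
    where
    open ≡-Reasoning
    μ a b c₁ c₂ : ℚ
    μ  = ι (suc m)
    a  = Δ^ (suc m) f (suc x)
    b  = Δ^ (suc m) f x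
    c₁ = Δ^ m f (suc x)
    c₂ = Δ^ m f (suc (suc x))
    regroup : ∀ x μ a b c d → (1ℚ + x) * a + μ * d - (x * b + μ * c) ≡ x * (a - b) + (a + μ * (d - c))
    regroup = solve-∀ ring
    collect : ∀ μ a → a + μ * a ≡ (1ℚ + μ) * a
    collect = solve-∀ ring

  Δ^-pow-< : ∀ r m x → r ℕ.< m → Δ^ m (λ y → powℚ (ι y) r) x ≡ 0ℚ
  Δ^-pow-< zero    (suc m) x _         = Δ^-const m 1ℚ x
  Δ^-pow-< (suc r) (suc m) x (s≤s r<m) = begin
    Δ^ (suc m) (λ y → powℚ (ι y) (suc r)) x          ≡⟨ Δ^-Leibniz m f x ⟩
    ι x * Δ^ (suc m) f x + ι (suc m) * Δ^ m f (suc x) ≡⟨ cong₂ (λ u v → ι x * u + ι (suc m) * v) (Δ^-pow-< r (suc m) x (ℕₚ.m≤n⇒m≤1+n r<m)) (Δ^-pow-< r m (suc x) r<m) ⟩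
    ι x * 0ℚ + ι (suc m) * 0ℚ                         ≡⟨ zeros (ι x) (ι (suc m)) ⟩
    0ℚ                                                ∎
    where
    open ≡-Reasoning
    f : ℕ → ℚ
    f y = powℚ (ι y) r
    zeros : ∀ a b → a * 0ℚ + b * 0ℚ ≡ 0ℚ
    zeros = solve-∀ ring

  -- The source of the factorial in Wilson's theorem. In the Leibniz rule the first term dies by
  -- `Δ^-pow-<`, and the second contributes the factor m+1.
  Δ^-pow : ∀ m x → Δ^ m (λ y → powℚ (ι y) m) x ≡ ι (m !)
  Δ^-pow zero    x = refl
  Δ^-pow (suc m) x = begin
    Δ^ (suc m) (λ y → powℚ (ι y) (suc m)) x          ≡⟨ Δ^-Leibniz m f x ⟩
    ι x * Δ^ (suc m) f x + ι (suc m) * Δ^ m f (suc x) ≡⟨ cong₂ (λ u v → ι x * u + ι (suc m) * v) (Δ^-pow-< m (suc m) x ℕₚ.≤-refl) (Δ^-pow m (suc x)) ⟩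
    ι x * 0ℚ + ι (suc m) * ι (m !)                    ≡⟨ zero+ (ι x) (ι (suc m) * ι (m !)) ⟩
    ι (suc m) * ι (m !)                               ≡⟨ ι-* (suc m) (m !) ⟨
    ι (suc m !)                                       ∎
    where
    open ≡-Reasoning
    f : ℕ → ℚ
    f y = powℚ (ι y) m
    zero+ : ∀ a b → a * 0ℚ + b ≡ b
    zero+ = solve-∀ ring

  positive? : ℕ → ℚ
  positive? zero    = 0ℚ
  positive? (suc _) = 1ℚ

  -- `positive?` is 1 minus the indicator of 0; the constant has zero differences, and the indicator
  -- contributes -(-1)^(m+1).
  Δ^-positive? : ∀ m → Δ^ (suc m) positive? 0 ≡ sgn m
  Δ^-positive? zero    = refl
  Δ^-positive? (suc m) = begin
    Δ^ (suc m) positive? 1 - Δ^ (suc m) positive? 0   ≡⟨ cong₂ _-_ (trans (Δ^-shift (suc m) positive? 0) (Δ^-const m 1ℚ 0)) (Δ^-positive? m) ⟩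
    0ℚ - sgn m                                        ≡⟨ negate (sgn m) ⟩
    sgn (suc m)                                       ∎
    where
    open ≡-Reasoning
    negate : ∀ s → 0ℚ - s ≡ - 1ℚ * s
    negate = solve-∀ ring

  -- `sumTo` includes its upper end and is never empty, whereas the sums over i < n used for inverse
  -- squares start from the empty one.
  sumBelow : ℕ → (ℕ → ℚ) → ℚ
  sumBelow zero    f = 0ℚ
  sumBelow (suc n) f = sumBelow n f + f n

  sumBelow-front : ∀ n (f : ℕ → ℚ) → sumBelow (suc n) f ≡ f 0 + sumBelow n (f ∘ suc)
  sumBelow-front zero    f = ℚₚ.+-comm 0ℚ (f 0)
  sumBelow-front (suc n) f = trans (cong (_+ f (suc n)) (sumBelow-front n f))
    (ℚₚ.+-assoc (f 0) (sumBelow n (f ∘ suc)) (f (suc n)))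

  sumBelow-reverse : ∀ n (f : ℕ → ℚ) → sumBelow n (λ i → f (n ℕ.∸ i)) ≡ sumBelow n (f ∘ suc)
  sumBelow-reverse zero    f = refl
  sumBelow-reverse (suc n) f = trans (sumBelow-front n (λ i → f (suc n ℕ.∸ i)))
    (trans (cong (λ u → f (suc n) + u) (sumBelow-reverse n f)) (ℚₚ.+-comm (f (suc n)) (sumBelow n (f ∘ suc))))

  sumBelow-* : ∀ n c (f : ℕ → ℚ) → sumBelow n (λ i → c * f i) ≡ c * sumBelow n f
  sumBelow-* zero    c f = sym (ℚₚ.*-zeroʳ c)
  sumBelow-* (suc n) c f = trans (cong (_+ c * f n) (sumBelow-* n c f))
    (sym (ℚₚ.*-distribˡ-+ c (sumBelow n f) (f n)))

  sumBelow-append : ∀ m n (f : ℕ → ℚ) → sumBelow (m ℕ.+ n) f ≡ sumBelow m f + sumBelow n (λ i → f (m ℕ.+ i))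
  sumBelow-append m zero    f = trans (cong (λ k → sumBelow k f) (ℕₚ.+-identityʳ m)) (sym (ℚₚ.+-identityʳ (sumBelow m f)))
  sumBelow-append m (suc n) f = begin
    sumBelow (m ℕ.+ suc n) f                                            ≡⟨ cong (λ k → sumBelow k f) (ℕₚ.+-suc m n) ⟩
    sumBelow (m ℕ.+ n) f + f (m ℕ.+ n)                                  ≡⟨ cong (_+ f (m ℕ.+ n)) (sumBelow-append m n f) ⟩
    sumBelow m f + sumBelow n (λ i → f (m ℕ.+ i)) + f (m ℕ.+ n)         ≡⟨ ℚₚ.+-assoc (sumBelow m f) (sumBelow n (λ i → f (m ℕ.+ i))) (f (m ℕ.+ n)) ⟩
    sumBelow m f + (sumBelow n (λ i → f (m ℕ.+ i)) + f (m ℕ.+ n))       ∎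
    where open ≡-Reasoning

  sumBelow-parity : ∀ n (f : ℕ → ℚ) →
    sumBelow (2 ℕ.* n) f ≡ sumBelow n (λ i → f (2 ℕ.* i)) + sumBelow n (λ i → f (suc (2 ℕ.* i)))
  sumBelow-parity zero    f = refl
  sumBelow-parity (suc n) f = begin
    sumBelow (2 ℕ.* suc n) f                                   ≡⟨ cong (λ k → sumBelow k f) (2*suc n) ⟩
    sumBelow (2 ℕ.* n) f + f (2 ℕ.* n) + f (suc (2 ℕ.* n))     ≡⟨ cong (λ u → u + f (2 ℕ.* n) + f (suc (2 ℕ.* n))) (sumBelow-parity n f) ⟩
    ev + od + f (2 ℕ.* n) + f (suc (2 ℕ.* n))                  ≡⟨ regroup ev od (f (2 ℕ.* n)) (f (suc (2 ℕ.* n))) ⟩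
    ev + f (2 ℕ.* n) + (od + f (suc (2 ℕ.* n)))                ∎
    where
    open ≡-Reasoning
    ev od : ℚ
    ev = sumBelow n (λ i → f (2 ℕ.* i))
    od = sumBelow n (λ i → f (suc (2 ℕ.* i)))
    regroup : ∀ a b c d → a + b + c + d ≡ a + c + (b + d)
    regroup = solve-∀ ring

  [2n]!-suc : ∀ n → ι ((2 ℕ.* suc n) !) ≡ ι 2 * ι (suc n) * (ι (suc (2 ℕ.* n)) * ι ((2 ℕ.* n) !))
  [2n]!-suc n = begin
    ι ((2 ℕ.* suc n) !)                                             ≡⟨ cong (λ k → ι (k !)) (2*suc n) ⟩
    ι (suc (suc (2 ℕ.* n)) !)                                       ≡⟨ ι-* (suc (suc (2 ℕ.* n))) (suc (2 ℕ.* n) !) ⟩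
    ι (suc (suc (2 ℕ.* n))) * ι (suc (2 ℕ.* n) !)                   ≡⟨ cong₂ _*_ (trans (cong ι (sym (2*suc n))) (ι-* 2 (suc n))) (ι-* (suc (2 ℕ.* n)) ((2 ℕ.* n) !)) ⟩
    ι 2 * ι (suc n) * (ι (suc (2 ℕ.* n)) * ι ((2 ℕ.* n) !))         ∎
    where open ≡-Reasoning

  central-factorial : ∀ n → central n * (ι (n !) * ι (n !)) ≡ ι ((2 ℕ.* n) !)
  central-factorial zero    = refl
  central-factorial (suc n) = begin
    c′ * (ι (suc n !) * ι (suc n !))                  ≡⟨ cong (λ u → c′ * (u * u)) (ι-* (suc n) (n !)) ⟩
    c′ * (ν * f * (ν * f))                            ≡⟨ regroup₁ c′ ν f ⟩
    ν * c′ * (ν * (f * f))                            ≡⟨ cong (_* (ν * (f * f))) (central-suc n) ⟩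
    ι 2 * w * central n * (ν * (f * f))               ≡⟨ regroup₂ (ι 2) w (central n) ν (f * f) ⟩
    ι 2 * ν * (w * (central n * (f * f)))             ≡⟨ cong (λ u → ι 2 * ν * (w * u)) (central-factorial n) ⟩
    ι 2 * ν * (w * ι ((2 ℕ.* n) !))                   ≡⟨ [2n]!-suc n ⟨
    ι ((2 ℕ.* suc n) !)                               ∎
    where
    open ≡-Reasoning
    c′ ν f w : ℚ
    c′ = central (suc n)
    ν = ι (suc n)
    f = ι (n !)
    w = ι (suc (2 ℕ.* n))
    regroup₁ : ∀ c ν f → c * (ν * f * (ν * f)) ≡ ν * c * (ν * (f * f))
    regroup₁ = solve-∀ ring
    regroup₂ : ∀ t w c ν f → t * w * c * (ν * f) ≡ t * ν * (w * (c * f))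
    regroup₂ = solve-∀ ring

  -- The double factorial (2n-1)!! = 1 · 3 ··· (2n-1).
  oddProduct : ℕ → ℕ
  oddProduct zero    = 1
  oddProduct (suc n) = oddProduct n ℕ.* suc (2 ℕ.* n)

  oddProduct-factorial : ∀ n → ι (oddProduct n) * powℚ (ι 2) n * ι (n !) ≡ ι ((2 ℕ.* n) !)
  oddProduct-factorial zero    = refl
  oddProduct-factorial (suc n) = begin
    ι (oddProduct n ℕ.* suc (2 ℕ.* n)) * (ι 2 * powℚ (ι 2) n) * ι (suc n !)
      ≡⟨ cong₂ (λ u v → u * (ι 2 * powℚ (ι 2) n) * v) (ι-* (oddProduct n) (suc (2 ℕ.* n))) (ι-* (suc n) (n !)) ⟩
    ι (oddProduct n) * w * (ι 2 * powℚ (ι 2) n) * (ι (suc n) * ι (n !))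
      ≡⟨ regroup (ι (oddProduct n)) w (ι 2) (powℚ (ι 2) n) (ι (suc n)) (ι (n !)) ⟩
    ι 2 * ι (suc n) * (w * (ι (oddProduct n) * powℚ (ι 2) n * ι (n !)))
      ≡⟨ cong (λ u → ι 2 * ι (suc n) * (w * u)) (oddProduct-factorial n) ⟩
    ι 2 * ι (suc n) * (w * ι ((2 ℕ.* n) !))
      ≡⟨ [2n]!-suc n ⟨
    ι ((2 ℕ.* suc n) !) ∎
    where
    open ≡-Reasoning
    w : ℚ
    w = ι (suc (2 ℕ.* n))
    regroup : ∀ o w t q ν f → o * w * (t * q) * (ν * f) ≡ t * ν * (w * (o * q * f))
    regroup = solve-∀ ring

  -- With x = p and k ≤ n this is on the one hand a quotient of factorials, on the other a
  -- p-adically small perturbation of (-1)^k ((2k-1)!!)².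
  squareDiffs : ℚ → ℕ → ℚ
  squareDiffs x zero    = 1ℚ
  squareDiffs x (suc k) = squareDiffs x k * (x * x - ι (suc (2 ℕ.* k)) * ι (suc (2 ℕ.* k)))

  -- Since (2n+1)² - (2k+1)² = 4 (n+k+1) (n-k), the product is 4^k (n+k)! / (n-k)!. The factorial of
  -- r = n-k is multiplied across to avoid a division.
  squareDiffs-factorial : ∀ n k r → k ℕ.+ r ≡ n →
    squareDiffs (ι (suc (2 ℕ.* n))) k * ι (r !) ≡ powℚ (ι 4) k * ι ((n ℕ.+ k) !)
  squareDiffs-factorial n zero    r refl = cong (λ m → 1ℚ * ι (m !)) (sym (ℕₚ.+-identityʳ r))
  squareDiffs-factorial n (suc k) r k+r≡n = begin
    squareDiffs x k * (x * x - w * w) * ι (r !)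
      ≡⟨ cong (λ u → squareDiffs x k * u * ι (r !)) gap ⟩
    squareDiffs x k * (ι 4 * ι (suc (n ℕ.+ k)) * ι (suc r)) * ι (r !)
      ≡⟨ regroup₁ (squareDiffs x k) (ι 4) (ι (suc (n ℕ.+ k))) (ι (suc r)) (ι (r !)) ⟩
    squareDiffs x k * (ι (suc r) * ι (r !)) * (ι 4 * ι (suc (n ℕ.+ k)))
      ≡⟨ cong (λ u → squareDiffs x k * u * (ι 4 * ι (suc (n ℕ.+ k)))) (ι-* (suc r) (r !)) ⟨
    squareDiffs x k * ι (suc r !) * (ι 4 * ι (suc (n ℕ.+ k)))
      ≡⟨ cong (_* (ι 4 * ι (suc (n ℕ.+ k)))) (squareDiffs-factorial n k (suc r) (trans (ℕₚ.+-suc k r) k+r≡n)) ⟩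
    powℚ (ι 4) k * ι ((n ℕ.+ k) !) * (ι 4 * ι (suc (n ℕ.+ k)))
      ≡⟨ regroup₂ (powℚ (ι 4) k) (ι ((n ℕ.+ k) !)) (ι 4) (ι (suc (n ℕ.+ k))) ⟩
    ι 4 * powℚ (ι 4) k * (ι (suc (n ℕ.+ k)) * ι ((n ℕ.+ k) !))
      ≡⟨ cong (λ u → ι 4 * powℚ (ι 4) k * u) (trans (cong (λ m → ι (m !)) (ℕₚ.+-suc n k)) (ι-* (suc (n ℕ.+ k)) ((n ℕ.+ k) !))) ⟨
    ι 4 * powℚ (ι 4) k * ι ((n ℕ.+ suc k) !) ∎
    where
    open ≡-Reasoning
    x w : ℚ
    x = ι (suc (2 ℕ.* n))
    w = ι (suc (2 ℕ.* k))
    odd : ∀ n → ι (suc (2 ℕ.* n)) ≡ 1ℚ + ι 2 * ι n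
    odd n = trans (ι-suc (2 ℕ.* n)) (cong (λ u → 1ℚ + u) (ι-* 2 n))
    n-split : ι n ≡ ι k + ι (suc r)
    n-split = trans (cong ι (trans (sym k+r≡n) (sym (ℕₚ.+-suc k r)))) (ι-+ k (suc r))
    factor : ∀ n k r → n ≡ k + r → (1ℚ + ι 2 * n) * (1ℚ + ι 2 * n) - (1ℚ + ι 2 * k) * (1ℚ + ι 2 * k)
           ≡ ι 4 * (1ℚ + (n + k)) * r
    factor _ k r refl = expand k r
      where
      expand : ∀ k r → (1ℚ + ι 2 * (k + r)) * (1ℚ + ι 2 * (k + r)) - (1ℚ + ι 2 * k) * (1ℚ + ι 2 * k)
             ≡ ι 4 * (1ℚ + (k + r + k)) * r
      expand = solve-∀ ring
    gap : x * x - w * w ≡ ι 4 * ι (suc (n ℕ.+ k)) * ι (suc r)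
    gap = begin
      x * x - w * w                                    ≡⟨ cong₂ (λ u v → u * u - v * v) (odd n) (odd k) ⟩
      (1ℚ + ι 2 * ι n) * (1ℚ + ι 2 * ι n) - (1ℚ + ι 2 * ι k) * (1ℚ + ι 2 * ι k)   ≡⟨ factor (ι n) (ι k) (ι (suc r)) n-split ⟩
      ι 4 * (1ℚ + (ι n + ι k)) * ι (suc r)             ≡⟨ cong (λ u → ι 4 * u * ι (suc r)) (trans (ι-suc (n ℕ.+ k)) (cong (λ u → 1ℚ + u) (ι-+ n k))) ⟨
      ι 4 * ι (suc (n ℕ.+ k)) * ι (suc r)              ∎
    regroup₁ : ∀ s f m r t → s * (f * m * r) * t ≡ s * (r * t) * (f * m)
    regroup₁ = solve-∀ ring
    regroup₂ : ∀ a b c d → a * b * (c * d) ≡ c * a * (d * b)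
    regroup₂ = solve-∀ ring

  -- From C(2n,n) n!² = (2n)! = (2n-1)!! 2^n n! and the value 4^n (2n)! of the product, both sides
  -- are 4^n ((2n)!)². The factor n!² stays until it can be cancelled modulo powers of p.
  squareDiffs-oddProduct : ∀ n → let x = squareDiffs (ι (suc (2 ℕ.* n))) n ; f² = ι (n !) * ι (n !) in
    central n * x * f² ≡ powℚ (ι 16) n * (ι (oddProduct n) * ι (oddProduct n)) * f²
  squareDiffs-oddProduct n = begin
    c * x * (f * f)              ≡⟨ regroup₁ c x (f * f) ⟩
    c * (f * f) * (x * ι (0 !))  ≡⟨ cong₂ _*_ (central-factorial n) (squareDiffs-factorial n n 0 (ℕₚ.+-identityʳ n)) ⟩
    t * (p₄ * ι ((n ℕ.+ n) !))   ≡⟨ cong (λ m → t * (p₄ * ι (m !))) (cong (λ m → n ℕ.+ m) (sym (ℕₚ.+-identityʳ n))) ⟩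
    t * (p₄ * t)                 ≡⟨ cong (λ u → u * (p₄ * u)) (oddProduct-factorial n) ⟨
    o * p₂ * f * (p₄ * (o * p₂ * f))     ≡⟨ regroup₂ o p₂ f p₄ ⟩
    p₄ * (p₂ * p₂) * (o * o) * (f * f)   ≡⟨ cong (λ u → u * (o * o) * (f * f)) powers ⟩
    powℚ (ι 16) n * (o * o) * (f * f)    ∎
    where
    open ≡-Reasoning
    c x f t o p₂ p₄ : ℚ
    c = central n
    x = squareDiffs (ι (suc (2 ℕ.* n))) n
    f = ι (n !)
    t = ι ((2 ℕ.* n) !)
    o = ι (oddProduct n)
    p₂ = powℚ (ι 2) n
    p₄ = powℚ (ι 4) n
    powers : p₄ * (p₂ * p₂) ≡ powℚ (ι 16) n
    powers = trans (cong (λ u → p₄ * u) (sym (powℚ-* (ι 2) (ι 2) n))) (sym (powℚ-* (ι 4) (ι 4) n))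
    regroup₁ : ∀ c x f → c * x * f ≡ c * f * (x * 1ℚ)
    regroup₁ = solve-∀ ring
    regroup₂ : ∀ o q f r → o * q * f * (r * (o * q * f)) ≡ r * (q * q) * (o * o) * (f * f)
    regroup₂ = solve-∀ ring

  -- The Legendre symbol of -1

  if-true : ∀ {A : Set} {b} {x y : A} → T b → (if b then x else y) ≡ x
  if-true {b = true} _ = refl

  if-false : ∀ {A : Set} {b} {x y : A} → ¬ T b → (if b then x else y) ≡ y
  if-false {b = true}  ¬t = contradiction _ ¬t
  if-false {b = false} _  = refl

  -- The modulus is at least 2, so that -1 reduces to a nonzero residue.
  module LegendreMinusOne (q : ℕ) where

    m : ℕ
    m = suc (suc q)

    test : ℕ → Bool
    test x = ((ℤ.+ x) ℤ.* (ℤ.+ x) ℤ.- ℤ.-1ℤ) %ℕ m ℕ.≡ᵇ 0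

    remainder : ∀ x → ((ℤ.+ x) ℤ.* (ℤ.+ x) ℤ.- ℤ.-1ℤ) %ℕ m ≡ (x ℕ.* x ℕ.+ 1) ℕ.% m
    remainder x = cong (λ z → (z ℤ.- ℤ.-1ℤ) %ℕ m) (sym (ℤₚ.pos-* x x))

    legendre-residue : ∀ {x} → x ℕ.< m → m ∣ x ℕ.* x ℕ.+ 1 → legendre ℤ.-1ℤ m ≡ ℤ.1ℤ
    legendre-residue {x} x<m m∣x²+1 = if-true
      (any⁺ test (lose {P = λ y → T (test y)} (∈-upTo⁺ x<m)
        (ℕₚ.≡⇒≡ᵇ _ 0 (trans (remainder x) (n∣m⇒m%n≡0 (x ℕ.* x ℕ.+ 1) m m∣x²+1)))))

    legendre-nonresidue : (∀ x → m ∤ x ℕ.* x ℕ.+ 1) → legendre ℤ.-1ℤ m ≡ ℤ.-1ℤ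
    legendre-nonresidue m∤ = if-false λ t →
      let x , _ , tx = find (any⁻ test (upTo m) t)
      in m∤ x (m%n≡0⇒n∣m (x ℕ.* x ℕ.+ 1) m (trans (sym (remainder x)) (ℕₚ.≡ᵇ⇒≡ _ 0 tx)))

  open LegendreMinusOne using (legendre-residue; legendre-nonresidue)

  parity : ∀ n → (∃ λ k → n ≡ 2 ℕ.* k) ⊎ (∃ λ k → n ≡ suc (2 ℕ.* k))
  parity zero    = inj₁ (0 , refl)
  parity (suc n) with parity n
  ... | inj₁ (k , refl) = inj₂ (k , refl)
  ... | inj₂ (k , refl) = inj₁ (suc k , sym (2*suc k))

  -- Odd primes: Fermat, Wilson and sums of inverse squares

  -- Here n = (p-1)/2 and h = (p-3)/2, so 2n and 2h are the exponents p-1 and p-3 with their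
  -- evenness visible.
  module Odd (p : ℕ) (p-prime : Prime p) (n h : ℕ)
             (p≡1+2n : p ≡ suc (2 ℕ.* n)) (2n≡2+2h : 2 ℕ.* n ≡ suc (suc (2 ℕ.* h))) (3<p : 3 ℕ.< p) where

    open Local p p-prime public

    p∤2 : p ∤ 2
    p∤2 = <⇒p∤ (ℕₚ.<-trans (ℕₚ.n<1+n 2) 3<p)

    p∤3 : p ∤ 3
    p∤3 = <⇒p∤ 3<p

    integral-½ : Integral p ½
    integral-½ = fraction (ℤ.+ 1) 2 p∤2 refl

    integral-1/16 : Integral p 1/16
    integral-1/16 = fraction (ℤ.+ 1) 16 (p∤* {4} {4} p∤4 p∤4) refl
      where
      p∤4 : p ∤ 4
      p∤4 = p∤* {2} {2} p∤2 p∤2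

    integral-sumBelow : ∀ k {f : ℕ → ℚ} → (∀ i → Integral p (f i)) → Integral p (sumBelow k f)
    integral-sumBelow zero    if = integral-ι 0
    integral-sumBelow (suc k) if = integral-+ (integral-sumBelow k if) (if k)

    2n<p : 2 ℕ.* n ℕ.< p
    2n<p = subst (2 ℕ.* n ℕ.<_) (sym p≡1+2n) ℕₚ.≤-refl

    n≤2n : n ℕ.≤ 2 ℕ.* n
    n≤2n = ℕₚ.m≤m+n n (n ℕ.+ 0)

    sgn-even : ∀ k → sgn (2 ℕ.* k) ≡ 1ℚ
    sgn-even k = trans (sym (powℚ-powℚ (- 1ℚ) 2 k)) (powℚ-1 k)

    pow-0 : ∀ {k} → 0 ℕ.< k → powℚ 0ℚ k ≡ 0ℚ
    pow-0 {suc k} _ = ℚₚ.*-zeroˡ (powℚ 0ℚ k)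

    absorption-p : ∀ k → suc k ℕ.* (p C suc k) ≡ p ℕ.* ((2 ℕ.* n) C k)
    absorption-p k = subst (λ m → suc k ℕ.* (m C suc k) ≡ m ℕ.* ((2 ℕ.* n) C k)) (sym p≡1+2n) (absorption (2 ℕ.* n) k)

    p∣pCk : ∀ k → suc k ℕ.< p → p ∣ (p C suc k)
    p∣pCk k k<p = [ (λ p∣k → contradiction p∣k (<⇒p∤ k<p)) , (λ p∣c → p∣c) ]′
      (euclidsLemma (suc k) (p C suc k) p-prime
        (subst (p ∣_) (sym (absorption-p k)) (m∣m*n ((2 ℕ.* n) C k))))

    -- The inner entries of row p are divisible by p, so by Pascal's rule neighbours in row p-1 are
    -- opposite modulo p.
    [p-1]Ck≈sgn : ∀ k → k ℕ.< p → ι ((2 ℕ.* n) C k) ≈[ 1 ] sgn k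
    [p-1]Ck≈sgn zero    _   = ≈-refl
    [p-1]Ck≈sgn (suc k) k<p = begin
      ι ((2 ℕ.* n) C suc k)                          ≈⟨ ≈-reflexive (isolate (ι ((2 ℕ.* n) C k)) (ι ((2 ℕ.* n) C suc k))) ⟩
      ι ((2 ℕ.* n) C k) + ι ((2 ℕ.* n) C suc k) - ι ((2 ℕ.* n) C k)
                                                     ≈⟨ ≈-reflexive (cong (_- ι ((2 ℕ.* n) C k)) (trans (sym (Pascal (2 ℕ.* n) k)) (cong (λ m → ι (m C suc k)) (sym p≡1+2n)))) ⟩
      ι (p C suc k) - ι ((2 ℕ.* n) C k)              ≈⟨ ≈-+ (p∣⇒≈0 (p∣pCk k k<p)) (≈-neg ([p-1]Ck≈sgn k (ℕₚ.<-trans (ℕₚ.n<1+n k) k<p))) ⟩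
      0ℚ - sgn k                                     ≈⟨ ≈-reflexive (negate (sgn k)) ⟩
      sgn (suc k)                                    ∎
      where
      open ≈-Reasoning (≈-setoid 1)
      isolate : ∀ a b → b ≡ a + b - a
      isolate = solve-∀ ring
      negate : ∀ s → 0ℚ - s ≡ - 1ℚ * s
      negate = solve-∀ ring

    sumTo-first : ∀ m q {f : ℕ → ℚ} → (∀ k → suc k ℕ.≤ q → f (suc k) ≈[ m ] 0ℚ) → sumTo q f ≈[ m ] f 0
    sumTo-first m zero    f≈0 = ≈-refl
    sumTo-first m (suc q) {f} f≈0 = ≈-trans
      (≈-+ (sumTo-first m q (λ k k<q → f≈0 k (ℕₚ.m≤n⇒m≤1+n k<q))) (f≈0 q ℕₚ.≤-refl))
      (≈-reflexive (ℚₚ.+-identityʳ (f 0)))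

    freshman : ∀ {x} → Integral p x → powℚ (1ℚ + x) p ≈[ 1 ] 1ℚ + powℚ x p
    freshman {x} ix = begin
      powℚ (1ℚ + x) p                   ≈⟨ ≈-reflexive (trans (sym (bt-pow p x)) (bt-sum p (powℚ x))) ⟩
      sumTo p f                         ≈⟨ ≈-reflexive (cong (λ m → sumTo m f) p≡1+2n) ⟩
      sumTo (2 ℕ.* n) f + f (suc (2 ℕ.* n)) ≈⟨ ≈-reflexive (cong (λ m → sumTo (2 ℕ.* n) f + f m) (sym p≡1+2n)) ⟩
      sumTo (2 ℕ.* n) f + f p           ≈⟨ ≈-+ (sumTo-first 1 (2 ℕ.* n) {f} middle) (≈-reflexive last) ⟩
      1ℚ + powℚ x p                     ∎
      where
      open ≈-Reasoning (≈-setoid 1)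
      f : ℕ → ℚ
      f k = ι (p C k) * powℚ x k
      middle : ∀ k → suc k ℕ.≤ 2 ℕ.* n → f (suc k) ≈[ 1 ] 0ℚ
      middle k k<2n = ≈-trans
        (≈-*ʳ (integral-pow (suc k) ix) (p∣⇒≈0 (p∣pCk k (ℕₚ.≤-<-trans k<2n 2n<p))))
        (≈-reflexive (ℚₚ.*-zeroˡ (powℚ x (suc k))))
      last : f p ≡ powℚ x p
      last = trans (cong (λ c → ι c * powℚ x p) (nCn≡1 p)) (ℚₚ.*-identityˡ (powℚ x p))

    pow-p : ∀ a → powℚ (ι a) p ≈[ 1 ] ι a
    pow-p zero    = ≈-reflexive (pow-0 (ℕₚ.<-trans (s≤s z≤n) 3<p))
    pow-p (suc a) = begin
      powℚ (ι (suc a)) p        ≈⟨ ≈-reflexive (cong (λ x → powℚ x p) (ι-suc a)) ⟩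
      powℚ (1ℚ + ι a) p         ≈⟨ freshman (integral-ι a) ⟩
      1ℚ + powℚ (ι a) p         ≈⟨ ≈-+ (≈-refl {1} {1ℚ}) (pow-p a) ⟩
      1ℚ + ι a                  ≈⟨ ≈-reflexive (sym (ι-suc a)) ⟩
      ι (suc a)                 ∎
      where open ≈-Reasoning (≈-setoid 1)

    Fermat : ∀ {a} → p ∤ a → powℚ (ι a) (2 ℕ.* n) ≈[ 1 ] 1ℚ
    Fermat {a} p∤a = ≈-cancel p∤a (begin
      ι a * powℚ (ι a) (2 ℕ.* n)   ≈⟨ ≈-reflexive (cong (powℚ (ι a)) (sym p≡1+2n)) ⟩
      powℚ (ι a) p                 ≈⟨ pow-p a ⟩
      ι a                          ≈⟨ ≈-reflexive (sym (ℚₚ.*-identityʳ (ι a))) ⟩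
      ι a * 1ℚ                     ∎)
      where open ≈-Reasoning (≈-setoid 1)

    Δ^-≈ : ∀ {m} k x {f g : ℕ → ℚ} → (∀ y → y ℕ.≤ x ℕ.+ k → f y ≈[ m ] g y) → Δ^ k f x ≈[ m ] Δ^ k g x
    Δ^-≈ zero    x f≈g = f≈g x (ℕₚ.≤-reflexive (sym (ℕₚ.+-identityʳ x)))
    Δ^-≈ (suc k) x f≈g = ≈-+
      (Δ^-≈ k (suc x) (λ y y≤ → f≈g y (subst (y ℕ.≤_) (sym (ℕₚ.+-suc x k)) y≤)))
      (≈-neg (Δ^-≈ k x (λ y y≤ → f≈g y (ℕₚ.≤-trans y≤ (ℕₚ.+-monoʳ-≤ x (ℕₚ.n≤1+n k))))))

    -- By Fermat y^(p-1) agrees modulo p with the indicator of y ≠ 0 at the points entering its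
    -- (p-1)-st difference at 0.
    Wilson : ι ((2 ℕ.* n) !) ≈[ 1 ] - 1ℚ
    Wilson = begin
      ι ((2 ℕ.* n) !)                                   ≈⟨ ≈-reflexive (sym (Δ^-pow (2 ℕ.* n) 0)) ⟩
      Δ^ (2 ℕ.* n) (λ y → powℚ (ι y) (2 ℕ.* n)) 0       ≈⟨ Δ^-≈ (2 ℕ.* n) 0 indicator ⟩
      -- Writing 2n as 2h + 2 shows that the resulting sign has the odd exponent 2h + 1.
      Δ^ (2 ℕ.* n) positive? 0                          ≈⟨ ≈-reflexive (cong (λ m → Δ^ m positive? 0) 2n≡2+2h) ⟩
      Δ^ (suc (suc (2 ℕ.* h))) positive? 0              ≈⟨ ≈-reflexive (Δ^-positive? (suc (2 ℕ.* h))) ⟩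
      - 1ℚ * sgn (2 ℕ.* h)                              ≈⟨ ≈-reflexive (cong (λ s → - 1ℚ * s) (sgn-even h)) ⟩
      - 1ℚ                                              ∎
      where
      open ≈-Reasoning (≈-setoid 1)
      indicator : ∀ y → y ℕ.≤ 2 ℕ.* n → powℚ (ι y) (2 ℕ.* n) ≈[ 1 ] positive? y
      indicator zero    _    = ≈-reflexive (pow-0 (subst (0 ℕ.<_) (sym 2n≡2+2h) (s≤s z≤n)))
      indicator (suc y) y≤2n = Fermat (<⇒p∤ (ℕₚ.≤-<-trans y≤2n 2n<p))

    -- The exponent is p - 3, so that g i is i⁻² modulo p.
    g : ℕ → ℚ
    g i = powℚ (ι i) (2 ℕ.* h)

    g-inverse : ∀ {i} → p ∤ i → ι i * ι i * g i ≈[ 1 ] 1ℚ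
    g-inverse {i} p∤i = ≈-trans
      (≈-reflexive (trans (ℚₚ.*-assoc (ι i) (ι i) (g i)) (cong (powℚ (ι i)) (sym 2n≡2+2h)))) (Fermat p∤i)

    integral-g : ∀ i → Integral p (g i)
    integral-g i = integral-pow (2 ℕ.* h) (integral-ι i)

    -- p - i ≡ -i, and the exponent 2h is even.
    g-reflect : ∀ {i} → i ℕ.≤ p → g i ≈[ 1 ] g (p ℕ.∸ i)
    g-reflect {i} i≤p = ≈-sym (begin
      powℚ (ι (p ℕ.∸ i)) (2 ℕ.* h)           ≈⟨ ≈-pow (2 ℕ.* h) (integral-ι (p ℕ.∸ i)) (integral-neg (integral-ι i)) p-i≈-i ⟩
      powℚ (- ι i) (2 ℕ.* h)                 ≈⟨ ≈-reflexive (cong (λ x → powℚ x (2 ℕ.* h)) (negate (ι i))) ⟩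
      powℚ (- 1ℚ * ι i) (2 ℕ.* h)            ≈⟨ ≈-reflexive (powℚ-* (- 1ℚ) (ι i) (2 ℕ.* h)) ⟩
      sgn (2 ℕ.* h) * g i                    ≈⟨ ≈-reflexive (trans (cong (_* g i) (sgn-even h)) (ℚₚ.*-identityˡ (g i))) ⟩
      g i                                    ∎)
      where
      open ≈-Reasoning (≈-setoid 1)
      negate : ∀ x → - x ≡ - 1ℚ * x
      negate = solve-∀ ring
      p-i≈-i : ι (p ℕ.∸ i) ≈[ 1 ] - ι i
      p-i≈-i = ≈-trans (≈-reflexive (ι-∸ i≤p))
        (≈-trans (≈-+ p≈0 (≈-refl {1} { - ι i})) (≈-reflexive (ℚₚ.+-identityˡ (- ι i))))

    g-double : ∀ i → g (2 ℕ.* i) ≡ g 2 * g i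
    g-double i = trans (cong (λ x → powℚ x (2 ℕ.* h)) (ι-* 2 i)) (powℚ-* (ι 2) (ι i) (2 ℕ.* h))

    ≈-sumBelow : ∀ {m} k {a b : ℕ → ℚ} → (∀ i → i ℕ.< k → a i ≈[ m ] b i) → sumBelow k a ≈[ m ] sumBelow k b
    ≈-sumBelow zero    a≈b = ≈-refl
    ≈-sumBelow (suc k) a≈b =
      ≈-+ (≈-sumBelow k (λ i i<k → a≈b i (ℕₚ.m≤n⇒m≤1+n i<k))) (a≈b k ℕₚ.≤-refl)

    H : ℚ
    H = sumBelow n (λ i → g (suc i))

    -- By 2i+1 = p - 2(n-i) the odd residues are, up to sign, the doubles of 1, ..., n.
    oddSum≈ : sumBelow n (λ i → g (suc (2 ℕ.* i))) ≈[ 1 ] g 2 * H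
    oddSum≈ = begin
      sumBelow n (λ i → g (suc (2 ℕ.* i)))       ≈⟨ ≈-sumBelow n reflect ⟩
      sumBelow n (λ i → g 2 * g (n ℕ.∸ i))       ≈⟨ ≈-reflexive (sumBelow-* n (g 2) (λ i → g (n ℕ.∸ i))) ⟩
      g 2 * sumBelow n (λ i → g (n ℕ.∸ i))       ≈⟨ ≈-reflexive (cong (λ s → g 2 * s) (sumBelow-reverse n g)) ⟩
      g 2 * H                                    ∎
      where
      open ≈-Reasoning (≈-setoid 1)
      reflect : ∀ i → i ℕ.< n → g (suc (2 ℕ.* i)) ≈[ 1 ] g 2 * g (n ℕ.∸ i)
      reflect i i<n = ≈-trans
        (g-reflect (subst (suc (2 ℕ.* i) ℕ.≤_) (sym p≡1+2n) (s≤s (ℕₚ.*-monoʳ-≤ 2 (ℕₚ.<⇒≤ i<n)))))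
        (≈-reflexive (trans
          (cong g (trans (cong (ℕ._∸ suc (2 ℕ.* i)) p≡1+2n) (sym (ℕₚ.*-distribˡ-∸ 2 n i))))
          (g-double (n ℕ.∸ i))))

    evenSum≡ : sumBelow n (λ i → g (suc (suc (2 ℕ.* i)))) ≡ g 2 * H
    evenSum≡ = trans (pointwise n) (sumBelow-* n (g 2) (λ i → g (suc i)))
      where
      pointwise : ∀ k → sumBelow k (λ i → g (suc (suc (2 ℕ.* i)))) ≡ sumBelow k (λ i → g 2 * g (suc i))
      pointwise zero    = refl
      pointwise (suc k) = cong₂ _+_ (pointwise k) (trans (cong g (sym (2*suc k))) (g-double (suc k)))

    -- By n+1+i = p - (n-i) the residues above n reflect onto 1, ..., n.
    fullSum≈ : sumBelow (2 ℕ.* n) (λ i → g (suc i)) ≈[ 1 ] H + H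
    fullSum≈ = begin
      sumBelow (2 ℕ.* n) (λ i → g (suc i))                    ≈⟨ ≈-reflexive (cong (λ m → sumBelow (n ℕ.+ m) (λ i → g (suc i))) (ℕₚ.+-identityʳ n)) ⟩
      sumBelow (n ℕ.+ n) (λ i → g (suc i))                    ≈⟨ ≈-reflexive (sumBelow-append n n (λ i → g (suc i))) ⟩
      H + sumBelow n (λ i → g (suc (n ℕ.+ i)))                ≈⟨ ≈-+ (≈-refl {1} {H}) (≈-sumBelow n reflect) ⟩
      H + sumBelow n (λ i → g (n ℕ.∸ i))                      ≈⟨ ≈-reflexive (cong (λ s → H + s) (sumBelow-reverse n g)) ⟩
      H + H                                                   ∎
      where
      open ≈-Reasoning (≈-setoid 1)
      2n≡n+n : 2 ℕ.* n ≡ n ℕ.+ n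
      2n≡n+n = cong (n ℕ.+_) (ℕₚ.+-identityʳ n)
      reflect : ∀ i → i ℕ.< n → g (suc (n ℕ.+ i)) ≈[ 1 ] g (n ℕ.∸ i)
      reflect i i<n = ≈-trans
        (g-reflect (subst (suc (n ℕ.+ i) ℕ.≤_) (sym (trans p≡1+2n (cong suc 2n≡n+n))) (s≤s (ℕₚ.+-monoʳ-≤ n (ℕₚ.<⇒≤ i<n)))))
        (≈-reflexive (cong g (trans (cong (ℕ._∸ suc (n ℕ.+ i)) (trans p≡1+2n (cong suc 2n≡n+n))) (ℕₚ.[m+n]∸[m+o]≡n∸o n n i))))

    -- Splitting Σ i⁻² over 1 ≤ i < p by parity and by size gives 2·(H/4) ≡ 2H.
    H≈0 : H ≈[ 1 ] 0ℚ
    -- 6 = 8 - 2: from 2H ≡ 2 g(2) H and 4 g(2) ≡ 1 follows 8H ≡ 2H, and 6 is invertible because p >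
    -- 3.
    H≈0 = ≈-cancel {1} {6} (p∤* {2} {3} p∤2 p∤3) (begin
      ι 6 * H                                            ≈⟨ ≈-reflexive (expand H) ⟩
      ι 4 * (H + H) - ι 2 * H                            ≈⟨ ≈-+ (≈-*ˡ (integral-ι 4) 2H≈) (≈-refl {1} { - (ι 2 * H)}) ⟩
      ι 4 * (g 2 * H + g 2 * H) - ι 2 * H                ≈⟨ ≈-reflexive (cong (_- ι 2 * H) (regroup (g 2) H)) ⟩
      ι 2 * ι 2 * g 2 * (ι 2 * H) - ι 2 * H              ≈⟨ ≈-+ (≈-*ʳ (integral-* (integral-ι 2) integral-H) (g-inverse p∤2)) (≈-refl {1} { - (ι 2 * H)}) ⟩
      1ℚ * (ι 2 * H) - ι 2 * H                           ≈⟨ ≈-reflexive (cancel H) ⟩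
      ι 6 * 0ℚ                                           ∎)
      where
      open ≈-Reasoning (≈-setoid 1)
      integral-H : Integral p H
      integral-H = integral-sumBelow n (λ i → integral-g (suc i))
      2H≈ : H + H ≈[ 1 ] g 2 * H + g 2 * H
      2H≈ = ≈-trans (≈-sym fullSum≈)
        (≈-trans (≈-reflexive (sumBelow-parity n (λ i → g (suc i)))) (≈-+ oddSum≈ (≈-reflexive evenSum≡)))
      expand : ∀ x → ι 6 * x ≡ ι 4 * (x + x) - ι 2 * x
      expand = solve-∀ ring
      regroup : ∀ c x → ι 4 * (c * x + c * x) ≡ ι 2 * ι 2 * c * (ι 2 * x)
      regroup = solve-∀ ring
      cancel : ∀ x → 1ℚ * (ι 2 * x) - ι 2 * x ≡ ι 6 * 0ℚ
      cancel = solve-∀ ring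

    oddSum≈0 : sumBelow n (λ i → g (suc (2 ℕ.* i))) ≈[ 1 ] 0ℚ
    oddSum≈0 = ≈-trans oddSum≈ (≈-trans (≈-*ˡ (integral-g 2) H≈0) (≈-reflexive (ℚₚ.*-zeroʳ (g 2))))

    -- Morley's congruence

    p∤1+2d : ∀ {d} → d ℕ.< n → p ∤ suc (2 ℕ.* d)
    p∤1+2d {d} d<n = <⇒p∤ (subst (suc (2 ℕ.* d) ℕ.<_) (sym p≡1+2n) (s≤s (ℕₚ.*-monoʳ-< 2 d<n)))

    -- Each factor is -w² (1 - p²/w²) with w = 2i+1, and from the product of the brackets only the
    -- terms up to p² survive modulo p³.
    squareDiffs≈ : ∀ k → k ℕ.≤ n → squareDiffs (ι p) k ≈[ 3 ]
      sgn k * (ι (oddProduct k) * ι (oddProduct k)) * (1ℚ - ι (p ℕ.^ 2) * sumBelow k (λ i → g (suc (2 ℕ.* i))))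
    squareDiffs≈ zero    _   = ≈-reflexive (trivial (ι (p ℕ.^ 2)))
      where
      trivial : ∀ P → 1ℚ ≡ 1ℚ * (1ℚ * 1ℚ) * (1ℚ - P * 0ℚ)
      trivial = solve-∀ ring
    squareDiffs≈ (suc k) k<n = begin
      squareDiffs (ι p) k * (ι p * ι p - w * w)
        ≈⟨ ≈-* (integral-+ (integral-* (integral-ι p) (integral-ι p)) (integral-neg (integral-* integral-w integral-w)))
               (integral-* integral-A (integral-+ (integral-ι 1) (integral-neg (integral-* (integral-ι (p ℕ.^ 2)) integral-G))))
               (squareDiffs≈ k (ℕₚ.<⇒≤ k<n)) factor≈ ⟩
      A * (1ℚ - P * G) * (P * (w * w * g o) - w * w)
        ≈⟨ ≈-reflexive (expand A P G w (g o)) ⟩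
      - A * (w * w) * (1ℚ - P * (G + g o)) + P * (P * (- A * (w * w) * (G * g o)))
        -- The cross term carries p² · p² and so drops out modulo p³.
        ≈⟨ ≈-+ (≈-refl {3} { - A * (w * w) * (1ℚ - P * (G + g o))})
               (≈-scale 2 (≈-weaken 1 (p^m≈0 2 (integral-* (integral-* (integral-neg integral-A) (integral-* integral-w integral-w)) (integral-* integral-G (integral-g o)))))) ⟩
      - A * (w * w) * (1ℚ - P * (G + g o)) + P * 0ℚ
        ≈⟨ ≈-reflexive (collect (sgn k) (ι (oddProduct k)) w P (G + g o)) ⟩
      - 1ℚ * sgn k * (ι (oddProduct k) * w * (ι (oddProduct k) * w)) * (1ℚ - P * (G + g o))
        ≈⟨ ≈-reflexive (cong (λ u → - 1ℚ * sgn k * (u * u) * (1ℚ - P * (G + g o))) (sym (ι-* (oddProduct k) o))) ⟩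
      sgn (suc k) * (ι (oddProduct (suc k)) * ι (oddProduct (suc k))) * (1ℚ - P * (G + g o)) ∎
      where
      open ≈-Reasoning (≈-setoid 3)
      o : ℕ
      o = suc (2 ℕ.* k)
      w P A G : ℚ
      w = ι o
      P = ι (p ℕ.^ 2)
      A = sgn k * (ι (oddProduct k) * ι (oddProduct k))
      G = sumBelow k (λ i → g (suc (2 ℕ.* i)))
      integral-w : Integral p w
      integral-w = integral-ι o
      integral-A : Integral p A
      integral-A = integral-* (integral-sgn k) (integral-* (integral-ι (oddProduct k)) (integral-ι (oddProduct k)))
      integral-G : Integral p G
      integral-G = integral-sumBelow k (λ i → integral-g (suc (2 ℕ.* i)))
      -- Since w² g(w) ≡ 1 modulo p, inserting it beside p² changes nothing modulo p³.
      factor≈ : ι p * ι p - w * w ≈[ 3 ] P * (w * w * g o) - w * w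
      factor≈ = ≈-+ (≈-trans (≈-reflexive p*p≡P) (≈-scale 2 (≈-sym (g-inverse {o} (p∤1+2d k<n))))) (≈-refl {3} { - (w * w)})
        where
        p*p≡P : ι p * ι p ≡ P * 1ℚ
        p*p≡P = trans (sym (ι-* p p)) (trans (cong (λ m → ι (p ℕ.* m)) (sym (ℕₚ.*-identityʳ p))) (sym (ℚₚ.*-identityʳ P)))
      expand : ∀ A P G w c → A * (1ℚ - P * G) * (P * (w * w * c) - w * w)
             ≡ - A * (w * w) * (1ℚ - P * (G + c)) + P * (P * (- A * (w * w) * (G * c)))
      expand = solve-∀ ring
      collect : ∀ s o w P G → - (s * (o * o)) * (w * w) * (1ℚ - P * G) + P * 0ℚ ≡ - 1ℚ * s * (o * w * (o * w)) * (1ℚ - P * G)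
      collect = solve-∀ ring

    p∤oddProduct : ∀ k → k ℕ.≤ n → p ∤ oddProduct k
    p∤oddProduct zero    _   = p∤1
    p∤oddProduct (suc k) k<n = p∤* (p∤oddProduct k (ℕₚ.<⇒≤ k<n)) (p∤1+2d k<n)

    p∤k! : ∀ k → k ℕ.< p → p ∤ k !
    p∤k! zero    _   = p∤1
    p∤k! (suc k) k<p = p∤* (<⇒p∤ k<p) (p∤k! k (ℕₚ.<-trans (ℕₚ.n<1+n k) k<p))

    -- Obtained from 16^n ≡ (-1)^n C(2n,n): the exact product identity is compared with
    -- `squareDiffs≈`, and ((2n-1)!!)² n!², which is prime to p, is cancelled.
    Morley : central n * powℚ 1/16 n ≈[ 3 ] sgn n
    Morley = begin
      c * q                          ≈⟨ ≈-reflexive (insert c q (sgn n) (sgn² n)) ⟩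
      q * sgn n * (c * sgn n)        ≈⟨ ≈-*ˡ (integral-* (integral-pow n integral-1/16) (integral-sgn n)) (≈-sym 16ⁿ≈) ⟩
      q * sgn n * powℚ (ι 16) n      ≈⟨ ≈-reflexive (remove q (sgn n) (powℚ (ι 16) n) inverse16) ⟩
      sgn n                          ∎
      where
      open ≈-Reasoning (≈-setoid 3)
      c q o f W G : ℚ
      c = central n
      q = powℚ 1/16 n
      o = ι (oddProduct n)
      f = ι (n !)
      W = squareDiffs (ι p) n
      G = sumBelow n (λ i → g (suc (2 ℕ.* i)))
      B : ℕ
      B = oddProduct n ℕ.* oddProduct n ℕ.* (n ! ℕ.* n !)
      p∤B : p ∤ B
      p∤B = p∤* (p∤* (p∤oddProduct n ℕₚ.≤-refl) (p∤oddProduct n ℕₚ.≤-refl)) (p∤* p∤n! p∤n!)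
        where
        p∤n! : p ∤ n !
        p∤n! = p∤k! n (ℕₚ.≤-<-trans n≤2n 2n<p)
      ιB : ι B ≡ o * o * (f * f)
      ιB = trans (ι-* (oddProduct n ℕ.* oddProduct n) (n ! ℕ.* n !)) (cong₂ _*_ (ι-* (oddProduct n) (oddProduct n)) (ι-* (n !) (n !)))
      inverse16 : q * powℚ (ι 16) n ≡ 1ℚ
      inverse16 = trans (sym (powℚ-* 1/16 (ι 16) n)) (powℚ-1 n)
      insert : ∀ c q s → s * s ≡ 1ℚ → c * q ≡ q * s * (c * s)
      insert c q s s²≡1 = trans (sym (ℚₚ.*-identityʳ (c * q))) (trans (cong (λ u → c * q * u) (sym s²≡1)) (shuffle c q s))
        where
        shuffle : ∀ c q s → c * q * (s * s) ≡ q * s * (c * s)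
        shuffle = solve-∀ ring
      remove : ∀ q s t → q * t ≡ 1ℚ → q * s * t ≡ s
      remove q s t qt≡1 = trans (shuffle q s t) (trans (cong (_* s) qt≡1) (ℚₚ.*-identityˡ s))
        where
        shuffle : ∀ q s t → q * s * t ≡ q * t * s
        shuffle = solve-∀ ring
      W≈ : W ≈[ 3 ] sgn n * (o * o)
      W≈ = begin
        W                                                 ≈⟨ squareDiffs≈ n ℕₚ.≤-refl ⟩
        sgn n * (o * o) * (1ℚ - ι (p ℕ.^ 2) * G)          ≈⟨ ≈-*ˡ (integral-* (integral-sgn n) (integral-* (integral-ι (oddProduct n)) (integral-ι (oddProduct n))))
                                                                 (≈-+ (≈-refl {3} {1ℚ}) (≈-neg (≈-scale 2 oddSum≈0))) ⟩
        sgn n * (o * o) * (1ℚ - ι (p ℕ.^ 2) * 0ℚ)         ≈⟨ ≈-reflexive (simplify (sgn n * (o * o)) (ι (p ℕ.^ 2))) ⟩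
        sgn n * (o * o)                                   ∎
        where
        simplify : ∀ a P → a * (1ℚ - P * 0ℚ) ≡ a
        simplify = solve-∀ ring
      exact : c * W * (f * f) ≡ powℚ (ι 16) n * (o * o) * (f * f)
      exact = trans (cong (λ m → c * squareDiffs (ι m) n * (f * f)) p≡1+2n) (squareDiffs-oddProduct n)
      16ⁿ≈ : powℚ (ι 16) n ≈[ 3 ] c * sgn n
      16ⁿ≈ = ≈-cancel p∤B (begin
        ι B * powℚ (ι 16) n                         ≈⟨ ≈-reflexive (trans (cong (_* powℚ (ι 16) n) ιB) (shuffle₁ (o * o) (f * f) (powℚ (ι 16) n))) ⟩
        powℚ (ι 16) n * (o * o) * (f * f)           ≈⟨ ≈-reflexive (sym exact) ⟩
        c * W * (f * f)                             ≈⟨ ≈-*ʳ (integral-* (integral-ι (n !)) (integral-ι (n !))) (≈-*ˡ (integral-ι ((2 ℕ.* n) C n)) W≈) ⟩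
        c * (sgn n * (o * o)) * (f * f)             ≈⟨ ≈-reflexive (trans (shuffle₂ c (sgn n) (o * o) (f * f)) (cong (_* (c * sgn n)) (sym ιB))) ⟩
        ι B * (c * sgn n)                           ∎)
        where
        shuffle₁ : ∀ a b c → a * b * c ≡ c * a * b
        shuffle₁ = solve-∀ ring
        shuffle₂ : ∀ c s a b → c * (s * a) * b ≡ a * b * (c * s)
        shuffle₂ = solve-∀ ring

    -- The quadratic character of -1 modulo p

    -1≈sgn*n!² : - 1ℚ ≈[ 1 ] sgn n * (ι (n !) * ι (n !))
    -1≈sgn*n!² = ≈-trans (≈-sym Wilson) (≈-trans (≈-reflexive (sym (central-factorial n)))
      (≈-*ʳ (integral-* (integral-ι (n !)) (integral-ι (n !))) ([p-1]Ck≈sgn n (ℕₚ.≤-<-trans n≤2n 2n<p))))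

    p≡3+2h : p ≡ suc (suc (suc (2 ℕ.* h)))
    p≡3+2h = trans p≡1+2n (cong suc 2n≡2+2h)

    ι-square+1 : ∀ x → ι (x ℕ.* x ℕ.+ 1) ≡ ι x * ι x + 1ℚ
    ι-square+1 x = trans (ι-+ (x ℕ.* x) 1) (cong (_+ 1ℚ) (ι-* x x))

    -- By Wilson's theorem C(2n,n) n!² = (2n)! ≡ -1, and C(2n,n) ≡ (-1)^n, so for even n the
    -- factorial n! is a square root of -1. It is reduced modulo p because `legendre` searches only
    -- below p.
    residue : sgn n ≡ 1ℚ → ∃ λ x → x ℕ.< p × p ∣ x ℕ.* x ℕ.+ 1
    residue sgn≡1 = r , m%n<n (n !) p , ≈0⇒p∣ (begin
      ι (r ℕ.* r ℕ.+ 1)             ≈⟨ ≈-reflexive (ι-square+1 r) ⟩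
      ι r * ι r + 1ℚ                ≈⟨ ≈-+ (≈-* (integral-ι r) (integral-ι (n !)) r≈n! r≈n!) (≈-refl {1} {1ℚ}) ⟩
      ι (n !) * ι (n !) + 1ℚ        ≈⟨ ≈-+ (≈-sym -1≈n!²) (≈-refl {1} {1ℚ}) ⟩
      - 1ℚ + 1ℚ                     ≈⟨ ≈-refl ⟩
      0ℚ                            ∎)
      where
      open ≈-Reasoning (≈-setoid 1)
      instance
        p≢0 : ℕ.NonZero p
        p≢0 = ℕ.>-nonZero (ℕₚ.<-trans (s≤s z≤n) 3<p)
      r t : ℕ
      r = n ! ℕ.% p
      t = n ! ℕ./ p
      r≈n! : ι r ≈[ 1 ] ι (n !)
      r≈n! = ≈-sym (begin
        ι (n !)                     ≈⟨ ≈-reflexive (cong ι (m≡m%n+[m/n]*n (n !) p)) ⟩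
        ι (r ℕ.+ t ℕ.* p)           ≈⟨ ≈-reflexive (ι-+ r (t ℕ.* p)) ⟩
        ι r + ι (t ℕ.* p)           ≈⟨ ≈-+ (≈-refl {1} {ι r}) (p∣⇒≈0 (n∣m*n t)) ⟩
        ι r + 0ℚ                    ≈⟨ ≈-reflexive (ℚₚ.+-identityʳ (ι r)) ⟩
        ι r                         ∎)
      -1≈n!² : - 1ℚ ≈[ 1 ] ι (n !) * ι (n !)
      -1≈n!² = ≈-trans -1≈sgn*n!² (≈-reflexive (trans (cong (_* (ι (n !) * ι (n !))) sgn≡1) (ℚₚ.*-identityˡ (ι (n !) * ι (n !)))))

    -- A root of x² ≡ -1 would give 1 ≡ x^(p-1) = (x²)^n ≡ (-1)^n = -1, so p would divide 2, which
    -- is what `1ℚ - - 1ℚ` evaluates to.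
    nonresidue : sgn n ≡ - 1ℚ → ∀ x → p ∤ x ℕ.* x ℕ.+ 1
    nonresidue sgn≡-1 x p∣x²+1 = p∤2 (≈0⇒p∣ {2} (begin
      1ℚ - - 1ℚ                                ≈⟨ ≈-+ (≈-sym (Fermat p∤x)) (≈-refl {1} { - - 1ℚ}) ⟩
      powℚ (ι x) (2 ℕ.* n) - - 1ℚ              ≈⟨ ≈-reflexive (cong (_- - 1ℚ) (sym (powℚ-powℚ (ι x) 2 n))) ⟩
      powℚ (powℚ (ι x) 2) n - - 1ℚ             ≈⟨ ≈-+ (≈-pow n (integral-pow 2 (integral-ι x)) (integral-neg (integral-ι 1)) x²≈-1) (≈-refl {1} { - - 1ℚ}) ⟩
      sgn n - - 1ℚ                             ≈⟨ ≈-reflexive (cong (_- - 1ℚ) sgn≡-1) ⟩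
      0ℚ                                       ∎))
      where
      open ≈-Reasoning (≈-setoid 1)
      p∤x : p ∤ x
      p∤x p∣x = p∤1 (∣m+n∣m⇒∣n p∣x²+1 (∣n⇒∣m*n x p∣x))
      rearrange : ∀ a → a * (a * 1ℚ) ≡ a * a + 1ℚ - 1ℚ
      rearrange = solve-∀ ring
      x²≈-1 : powℚ (ι x) 2 ≈[ 1 ] - 1ℚ
      x²≈-1 = begin
        ι x * (ι x * 1ℚ)            ≈⟨ ≈-reflexive (rearrange (ι x)) ⟩
        ι x * ι x + 1ℚ - 1ℚ         ≈⟨ ≈-reflexive (cong (_- 1ℚ) (sym (ι-square+1 x))) ⟩
        ι (x ℕ.* x ℕ.+ 1) - 1ℚ      ≈⟨ ≈-+ (p∣⇒≈0 p∣x²+1) (≈-refl {1} { - 1ℚ}) ⟩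
        0ℚ - 1ℚ                     ≈⟨ ≈-refl ⟩
        - 1ℚ                        ∎

    legendre≡sgn : ζ (legendre ℤ.-1ℤ p) ≡ sgn n
    legendre≡sgn = [ even , odd ]′ (parity n)
      where
      even : (∃ λ k → n ≡ 2 ℕ.* k) → ζ (legendre ℤ.-1ℤ p) ≡ sgn n
      even (k , n≡2k) =
        let sgn≡1 = trans (cong sgn n≡2k) (sgn-even k)
            x , x<p , p∣ = residue sgn≡1
            value = subst (λ m → x ℕ.< m → m ∣ x ℕ.* x ℕ.+ 1 → legendre ℤ.-1ℤ m ≡ ℤ.1ℤ) (sym p≡3+2h)
                      (legendre-residue (suc (2 ℕ.* h)))
        in trans (cong ζ (value x<p p∣)) (sym sgn≡1)
      odd : (∃ λ k → n ≡ suc (2 ℕ.* k)) → ζ (legendre ℤ.-1ℤ p) ≡ sgn n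
      odd (k , n≡1+2k) =
        let sgn≡-1 = trans (cong sgn n≡1+2k) (cong (λ s → - 1ℚ * s) (sgn-even k))
            value = subst (λ m → (∀ x → m ∤ x ℕ.* x ℕ.+ 1) → legendre ℤ.-1ℤ m ≡ ℤ.-1ℤ) (sym p≡3+2h)
                      (legendre-nonresidue (suc (2 ℕ.* h)))
        in trans (cong ζ (value (nonresidue sgn≡-1))) (sym sgn≡-1)

    -- Euler polynomials modulo p

    bt-≈ : ∀ {m} k {a b : ℕ → ℚ} → (∀ i → i ℕ.≤ k → a i ≈[ m ] b i) → bt a k ≈[ m ] bt b k
    bt-≈ zero    a≈b = a≈b 0 z≤n
    bt-≈ (suc k) a≈b = ≈-+ (bt-≈ k (λ i i≤k → a≈b i (ℕₚ.m≤n⇒m≤1+n i≤k))) (bt-≈ k (λ i i≤k → a≈b (suc i) (s≤s i≤k)))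

    -- The top entry enters `bt a k` with coefficient 1, so the difference involves only earlier
    -- entries.
    bt-lower-≈ : ∀ {m} k {a b : ℕ → ℚ} → (∀ i → i ℕ.< k → a i ≈[ m ] b i) → bt a k - a k ≈[ m ] bt b k - b k
    bt-lower-≈ zero    {a} {b} _ = ≈-reflexive (trans (ℚₚ.+-inverseʳ (a 0)) (sym (ℚₚ.+-inverseʳ (b 0))))
    bt-lower-≈ {m} (suc k) {a} {b} a≈b = subst₂ (λ u v → u ≈[ m ] v)
      (sym (ℚₚ.+-assoc (bt a k) (bt (a ∘ suc) k) (- a (suc k))))
      (sym (ℚₚ.+-assoc (bt b k) (bt (b ∘ suc) k) (- b (suc k))))
      (≈-+ (bt-≈ k (λ i i≤k → a≈b i (s≤s i≤k))) (bt-lower-≈ k {a ∘ suc} {b ∘ suc} (λ i i<k → a≈b (suc i) (s≤s i<k))))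

    -- The sequence `a k + bt a k` has generating function (1 + eᵗ) A(t), and 1 + eᵗ has constant
    -- term 2, a unit modulo p. The identities for Euler polynomials below are proved by multiplying
    -- both sides by 1 + eᵗ and cancelling it in this way.
    1+bt-injective : ∀ {m} {a b : ℕ → ℚ} → (∀ k → a k + bt a k ≈[ m ] b k + bt b k) → ∀ k → a k ≈[ m ] b k
    1+bt-injective {m} {a} {b} L≈ k = below (suc k) k ℕₚ.≤-refl
      where
      halve : ∀ u v → ½ * (u + v - (v - u)) ≡ u
      halve = solve-∀ ring
      below : ∀ j i → i ℕ.< j → a i ≈[ m ] b i
      -- a_i is half of (a_i + bt a i) - (bt a i - a_i), and the subtracted bracket is settled by
      -- smaller indices.
      below (suc j) i (s≤s i≤j) = subst₂ (λ u v → u ≈[ m ] v) (halve (a i) (bt a i)) (halve (b i) (bt b i))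
        (≈-*ˡ integral-½ (≈-+ (L≈ i) (≈-neg (bt-lower-≈ i {a} {b} (λ l l<i → below j l (ℕₚ.<-≤-trans l<i i≤j))))))

    -- Multiplied by 1 + eᵗ, both generating functions become 2 e^((1+x)t).
    euler-shift : ∀ {m} x k → E (1ℚ + x) k ≈[ m ] bt (E x) k
    euler-shift x = 1+bt-injective (λ k → ≈-reflexive (begin
      E (1ℚ + x) k + bt (E (1ℚ + x)) k            ≡⟨ euler-bt (1ℚ + x) k ⟩
      ι 2 * powℚ (1ℚ + x) k                       ≡⟨ cong (λ u → ι 2 * u) (bt-pow k x) ⟨
      ι 2 * bt (powℚ x) k                         ≡⟨ bt-* k (ι 2) (powℚ x) ⟨
      bt (λ i → ι 2 * powℚ x i) k                 ≡⟨ bt-cong k (euler-bt x) ⟨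
      bt (λ i → E x i + bt (E x) i) k             ≡⟨ bt-+ k (E x) (bt (E x)) ⟩
      bt (E x) k + bt (bt (E x)) k                ∎))
      where open ≡-Reasoning

    euler-recurrence : ∀ {m} x k → E x k + E (1ℚ + x) k ≈[ m ] ι 2 * powℚ x k
    euler-recurrence {m} x k = ≈-trans (≈-+ (≈-refl {m} {E x k}) (euler-shift x k)) (≈-reflexive (euler-bt x k))

    -- Multiplication by 1 + eᵗ turns the sequence into 2 xᵏ, which for p-integral x depends only on
    -- x modulo p^m. This is what moves the argument p/2 to 0.
    euler-≈ : ∀ {m x y} → Integral p x → Integral p y → x ≈[ m ] y → ∀ k → E x k ≈[ m ] E y k
    euler-≈ {m} {x} {y} ix iy x≈y = 1+bt-injective (λ k → subst₂ (λ u v → u ≈[ m ] v)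
      (sym (euler-bt x k)) (sym (euler-bt y k)) (≈-*ˡ (integral-ι 2) (≈-pow k ix iy x≈y)))

    -- The reflection formula (-1)^k E_k(1) = E_k(0), where E_k(1) is written as `bt (E 0ℚ) k`; by
    -- `bt-sgn-bt` the left side satisfies the equation that determines the right.
    euler-reflect-0 : ∀ {m} k → sgn k * bt (E 0ℚ) k ≈[ m ] E 0ℚ k
    euler-reflect-0 = 1+bt-injective (λ k → ≈-reflexive (begin
      sgn k * bt (E 0ℚ) k + bt (λ i → sgn i * bt (E 0ℚ) i) k    ≡⟨ cong (λ u → sgn k * bt (E 0ℚ) k + u) (bt-sgn-bt k (E 0ℚ)) ⟩
      sgn k * bt (E 0ℚ) k + sgn k * E 0ℚ k                      ≡⟨ factor (sgn k) (bt (E 0ℚ) k) (E 0ℚ k) ⟩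
      sgn k * (E 0ℚ k + bt (E 0ℚ) k)                            ≡⟨ cong (λ u → sgn k * u) (euler-bt 0ℚ k) ⟩
      sgn k * (ι 2 * powℚ 0ℚ k)                                 ≡⟨ sgn-pow-0 k ⟩
      ι 2 * powℚ 0ℚ k                                           ≡⟨ euler-bt 0ℚ k ⟨
      E 0ℚ k + bt (E 0ℚ) k                                      ∎))
      where
      open ≡-Reasoning
      factor : ∀ s u v → s * u + s * v ≡ s * (v + u)
      factor = solve-∀ ring
      zeros : ∀ s u → s * (ι 2 * (0ℚ * u)) ≡ ι 2 * (0ℚ * u)
      zeros = solve-∀ ring
      -- 0^k is nonzero only for k = 0, where the sign is 1.
      sgn-pow-0 : ∀ k → sgn k * (ι 2 * powℚ 0ℚ k) ≡ ι 2 * powℚ 0ℚ k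
      sgn-pow-0 zero    = refl
      sgn-pow-0 (suc k) = zeros (sgn (suc k)) (powℚ 0ℚ k)

    0<2h : 0 ℕ.< 2 ℕ.* h
    0<2h = ℕ.s≤s⁻¹ (ℕ.s≤s⁻¹ (ℕ.s≤s⁻¹ (subst (3 ℕ.<_) p≡3+2h 3<p)))

    -- For even k > 0 reflection gives E_k(1) = E_k(0), while the two add up to 2 · 0^k = 0. The
    -- index 2h is positive because p > 3.
    euler-0 : E 0ℚ (2 ℕ.* h) ≈[ 1 ] 0ℚ
    euler-0 = ≈-cancel p∤2 (begin
      ι 2 * e                            ≈⟨ ≈-reflexive (double e) ⟩
      e + e                              ≈⟨ ≈-+ (≈-refl {1} {e}) (≈-sym (euler-reflect-0 (2 ℕ.* h))) ⟩
      e + sgn (2 ℕ.* h) * bt (E 0ℚ) (2 ℕ.* h)   ≈⟨ ≈-reflexive (cong (λ u → e + u) (trans (cong (_* bt (E 0ℚ) (2 ℕ.* h)) (sgn-even h)) (ℚₚ.*-identityˡ (bt (E 0ℚ) (2 ℕ.* h))))) ⟩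
      e + bt (E 0ℚ) (2 ℕ.* h)            ≈⟨ ≈-reflexive (euler-bt 0ℚ (2 ℕ.* h)) ⟩
      ι 2 * powℚ 0ℚ (2 ℕ.* h)            ≈⟨ ≈-reflexive (cong (λ u → ι 2 * u) (pow-0 0<2h)) ⟩
      ι 2 * 0ℚ                           ∎)
      where
      open ≈-Reasoning (≈-setoid 1)
      e : ℚ
      e = E 0ℚ (2 ℕ.* h)
      double : ∀ u → ι 2 * u ≡ u + u
      double = solve-∀ ring

    ι-p : ι p ≡ 1ℚ + ι 2 * ι n
    ι-p = trans (cong ι p≡1+2n) (trans (ι-suc (2 ℕ.* n)) (cong (λ u → 1ℚ + u) (ι-* 2 n)))

    n+½≈0 : ι n + ½ ≈[ 1 ] 0ℚ
    n+½≈0 = begin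
      ι n + ½                      ≈⟨ ≈-reflexive (halve (ι n)) ⟩
      ½ * (1ℚ + ι 2 * ι n)         ≈⟨ ≈-reflexive (cong (λ u → ½ * u) (sym ι-p)) ⟩
      ½ * ι p                      ≈⟨ ≈-*ˡ integral-½ p≈0 ⟩
      ½ * 0ℚ                       ≈⟨ ≈-reflexive (ℚₚ.*-zeroʳ ½) ⟩
      0ℚ                           ∎
      where
      open ≈-Reasoning (≈-setoid 1)
      halve : ∀ x → x + ½ ≡ ½ * (1ℚ + ι 2 * x)
      halve = solve-∀ ring

    e : ℕ → ℚ
    e d = E (ι d + ½) (2 ℕ.* h)

    e-top : e n ≈[ 1 ] 0ℚ
    e-top = ≈-trans (euler-≈ (integral-+ (integral-ι n) integral-½) (integral-ι 0) n+½≈0 (2 ℕ.* h)) euler-0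

    e-recurrence : ∀ d → e d + e (suc d) ≈[ 1 ] ι 2 * powℚ (ι d + ½) (2 ℕ.* h)
    e-recurrence d = ≈-trans
      (≈-reflexive (cong (λ x → e d + E x (2 ℕ.* h)) (trans (cong (_+ ½) (ι-suc d)) (ℚₚ.+-assoc 1ℚ (ι d) ½))))
      (euler-recurrence (ι d + ½) (2 ℕ.* h))

    S : ℕ → ℚ
    S d = sumTo n (summand d)

    -- Fermat's theorem is available for integers, so the power of y = (2d+1)/2 is first multiplied
    -- by 2^(p-1) ≡ 1.
    half-integer-Fermat : ∀ d → d ℕ.< n → let y = ι d + ½ in y * y * powℚ y (2 ℕ.* h) ≈[ 1 ] 1ℚ
    half-integer-Fermat d d<n = begin
      y * y * powℚ y (2 ℕ.* h)                                    ≈⟨ ≈-reflexive (trans (ℚₚ.*-assoc y y (powℚ y (2 ℕ.* h))) (cong (powℚ y) (sym 2n≡2+2h))) ⟩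
      powℚ y (2 ℕ.* n)                                            ≈⟨ ≈-reflexive (sym (ℚₚ.*-identityˡ (powℚ y (2 ℕ.* n)))) ⟩
      1ℚ * powℚ y (2 ℕ.* n)                                       ≈⟨ ≈-*ʳ (integral-pow (2 ℕ.* n) integral-y) (≈-sym (Fermat p∤2)) ⟩
      powℚ (ι 2) (2 ℕ.* n) * powℚ y (2 ℕ.* n)                     ≈⟨ ≈-reflexive (sym (powℚ-* (ι 2) y (2 ℕ.* n))) ⟩
      powℚ (ι 2 * y) (2 ℕ.* n)                                    ≈⟨ ≈-reflexive (cong (λ x → powℚ x (2 ℕ.* n)) 2y≡) ⟩
      powℚ (ι (suc (2 ℕ.* d))) (2 ℕ.* n)                          ≈⟨ Fermat (p∤1+2d d<n) ⟩
      1ℚ                                                          ∎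
      where
      open ≈-Reasoning (≈-setoid 1)
      y : ℚ
      y = ι d + ½
      integral-y : Integral p y
      integral-y = integral-+ (integral-ι d) integral-½
      double : ∀ x → ι 2 * (x + ½) ≡ 1ℚ + ι 2 * x
      double = solve-∀ ring
      2y≡ : ι 2 * y ≡ ι (suc (2 ℕ.* d))
      2y≡ = trans (double (ι d)) (sym (trans (ι-suc (2 ℕ.* d)) (cong (λ u → 1ℚ + u) (ι-* 2 d))))

    -- The two congruences

    ¼ : ℚ
    ¼ = (ℤ.+ 1) ℚ./ 4

    integral-¼ : Integral p ¼
    integral-¼ = integral-* integral-½ integral-½

    P : ℚ
    P = ι (p ℕ.^ 2)

    p*p≡P : ι p * ι p ≡ P
    p*p≡P = trans (sym (ι-* p p)) (cong (λ m → ι (p ℕ.* m)) (sym (ℕₚ.*-identityʳ p)))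

    -- With y = d + ½ the coefficient 2 (-1)^d / (2d+1)² is (-1)^d y^(-2) / 2, and y^(-2) is written
    -- y^(p-3) to match the Euler recurrence. The denominators 2d+1 and n+d+1 are cleared first.
    S-difference : ∀ d → d ℕ.< n → S d - S (suc d) ≈[ 3 ] P * (sgn d * ½ * powℚ (ι d + ½) (2 ℕ.* h))
    S-difference d d<n = ≈-cancel (p∤1+2d d<n) (≈-cancel p∤j (begin
      ι j * (ι (suc (2 ℕ.* d)) * (S d - S (suc d)))                      ≈⟨ ≈-reflexive exact ⟩
      -- Behind p² both u and the binomial count only modulo p, where they are signs.
      P * (central n * q * ι ((2 ℕ.* n) C (n ℕ.+ d)))                    ≈⟨ ≈-scale 2 (≈-* (integral-ι ((2 ℕ.* n) C (n ℕ.+ d))) (integral-sgn n) (≈-weaken 2 Morley) ([p-1]Ck≈sgn (n ℕ.+ d) (ℕₚ.<-trans (ℕₚ.n<1+n (n ℕ.+ d)) j<p))) ⟩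
      P * (sgn n * sgn (n ℕ.+ d))                                        ≈⟨ ≈-reflexive (cong (λ u → P * u) signs) ⟩
      P * (sgn d * 1ℚ)                                                   ≈⟨ ≈-scale 2 (≈-*ˡ (integral-sgn d) (≈-sym (half-integer-Fermat d d<n))) ⟩
      P * (sgn d * (y * y * Y))                                          ≈⟨ ≈-reflexive (cong (λ u → P * u) (shuffle₁ (sgn d) y Y)) ⟩
      -- y + (n + ½) is exactly n+d+1, so one y turns into that denominator and the other is
      -- (2d+1)/2.
      P * ((y + 0ℚ) * (y * sgn d * Y))                                   ≈⟨ ≈-scale 2 (≈-*ʳ (integral-* (integral-* integral-y (integral-sgn d)) (integral-pow (2 ℕ.* h) integral-y)) (≈-+ (≈-refl {1} {y}) (≈-sym n+½≈0))) ⟩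
      P * ((y + (ι n + ½)) * (y * sgn d * Y))                            ≈⟨ ≈-reflexive (shuffle₂ P (ι n) (ι d) (sgn d) Y) ⟩
      (1ℚ + (ι n + ι d)) * ((1ℚ + ι 2 * ι d) * (P * (sgn d * ½ * Y)))    ≈⟨ ≈-reflexive (cong₂ (λ u v → u * (v * (P * (sgn d * ½ * Y)))) (sym ι-j) (sym ι-1+2d)) ⟩
      ι j * (ι (suc (2 ℕ.* d)) * (P * (sgn d * ½ * Y)))                  ∎))
      where
      open ≈-Reasoning (≈-setoid 3)
      j : ℕ
      j = suc (n ℕ.+ d)
      q y Y c : ℚ
      q = powℚ 1/16 n
      y = ι d + ½
      Y = powℚ y (2 ℕ.* h)
      c = ι ((2 ℕ.* n) C (n ℕ.+ d))
      integral-y : Integral p y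
      integral-y = integral-+ (integral-ι d) integral-½
      ι-j : ι j ≡ 1ℚ + (ι n + ι d)
      ι-j = trans (ι-suc (n ℕ.+ d)) (cong (λ u → 1ℚ + u) (ι-+ n d))
      ι-1+2d : ι (suc (2 ℕ.* d)) ≡ 1ℚ + ι 2 * ι d
      ι-1+2d = trans (ι-suc (2 ℕ.* d)) (cong (λ u → 1ℚ + u) (ι-* 2 d))
      j<p : j ℕ.< p
      j<p = subst (j ℕ.<_) (sym p≡1+2n)
        (s≤s (ℕₚ.+-monoʳ-< n (subst (d ℕ.<_) (sym (ℕₚ.+-identityʳ n)) d<n)))
      p∤j : p ∤ j
      p∤j = <⇒p∤ j<p
      exact : ι j * (ι (suc (2 ℕ.* d)) * (S d - S (suc d))) ≡ P * (central n * q * c)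
      exact = E.begin
        ι j * (ι (suc (2 ℕ.* d)) * (S d - S (suc d)))           E.≡⟨ cong (λ u → ι j * u) (sum-difference d n) ⟩
        ι j * boundary d n                                      E.≡⟨ cong (λ m → ι j * (ι m * central n * ι (m C j) * q)) (sym p≡1+2n) ⟩
        ι j * (ι p * central n * ι (p C j) * q)                 E.≡⟨ shuffle (ι j) (ι p) (central n) (ι (p C j)) q ⟩
        ι p * (ι j * ι (p C j)) * (central n * q)               E.≡⟨ cong (λ u → ι p * u * (central n * q)) absorb ⟩
        ι p * (ι p * c) * (central n * q)                       E.≡⟨ shuffle′ (ι p) c (central n * q) ⟩
        ι p * ι p * (central n * q * c)                         E.≡⟨ cong (_* (central n * q * c)) p*p≡P ⟩
        P * (central n * q * c)                                 E.∎
        where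
        module E = ≡-Reasoning
        absorb : ι j * ι (p C j) ≡ ι p * c
        absorb = trans (sym (ι-* j (p C j))) (trans (cong ι (absorption-p (n ℕ.+ d))) (ι-* p ((2 ℕ.* n) C (n ℕ.+ d))))
        shuffle : ∀ j p a b q → j * (p * a * b * q) ≡ p * (j * b) * (a * q)
        shuffle = solve-∀ ring
        shuffle′ : ∀ p c a → p * (p * c) * a ≡ p * p * (a * c)
        shuffle′ = solve-∀ ring
      signs : sgn n * sgn (n ℕ.+ d) ≡ sgn d * 1ℚ
      signs = trans (cong (λ u → sgn n * u) (powℚ-+ (- 1ℚ) n d))
        (trans (rotate (sgn n) (sgn d)) (cong (λ u → sgn d * u) (sgn² n)))
        where
        rotate : ∀ a b → a * (a * b) ≡ b * (a * a)
        rotate = solve-∀ ring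
      shuffle₁ : ∀ s y Y → s * (y * y * Y) ≡ (y + 0ℚ) * (y * s * Y)
      shuffle₁ = solve-∀ ring
      shuffle₂ : ∀ P n d s Y → P * ((d + ½ + (n + ½)) * ((d + ½) * s * Y)) ≡ (1ℚ + (n + d)) * ((1ℚ + ι 2 * d) * (P * (s * ½ * Y)))
      shuffle₂ = solve-∀ ring

    d+suc : ∀ {d r} → d ℕ.+ suc r ≡ n → d ℕ.< n × suc d ℕ.+ r ≡ n
    d+suc {d} {r} eq = subst (d ℕ.<_) eq′ (ℕₚ.m≤m+n (suc d) r) , eq′
      where
      eq′ : suc d ℕ.+ r ≡ n
      eq′ = trans (sym (ℕₚ.+-suc d r)) eq

    -- Downward induction in d, with r = n - d.
    S-mod-p³ : ∀ r d → d ℕ.+ r ≡ n → S d ≈[ 3 ] sgn n + P * sgn d * ¼ * e d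
    S-mod-p³ zero d d+0≡n = subst (λ k → S k ≈[ 3 ] sgn n + P * sgn k * ¼ * e k)
      (trans (sym d+0≡n) (ℕₚ.+-identityʳ d)) (begin
      S n                                   ≈⟨ ≈-reflexive (sum-summand-top n) ⟩
      central n * powℚ 1/16 n               ≈⟨ Morley ⟩
      sgn n                                 ≈⟨ ≈-reflexive (pad (sgn n) P (sgn n * ¼)) ⟩
      sgn n + P * (sgn n * ¼ * 0ℚ)          ≈⟨ ≈-+ (≈-refl {3} {sgn n}) (≈-scale 2 (≈-*ˡ (integral-* (integral-sgn n) integral-¼) (≈-sym e-top))) ⟩
      sgn n + P * (sgn n * ¼ * e n)         ≈⟨ ≈-reflexive (reassociate (sgn n) P (sgn n) ¼ (e n)) ⟩
      sgn n + P * sgn n * ¼ * e n           ∎)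
      where
      open ≈-Reasoning (≈-setoid 3)
      pad : ∀ s P a → s ≡ s + P * (a * 0ℚ)
      pad = solve-∀ ring
      reassociate : ∀ s P t f e → s + P * (t * f * e) ≡ s + P * t * f * e
      reassociate = solve-∀ ring
    S-mod-p³ (suc r) d eq = begin
      S d                                                          ≈⟨ ≈-reflexive (insert (S d) (S (suc d))) ⟩
      S d - S (suc d) + S (suc d)                                  ≈⟨ ≈-+ (S-difference d (proj₁ (d+suc eq))) (S-mod-p³ r (suc d) (proj₂ (d+suc eq))) ⟩
      P * (s * ½ * Y) + (sgn n + P * (- 1ℚ * s) * ¼ * e (suc d))   ≈⟨ ≈-reflexive (prepare P s Y (sgn n) (e (suc d))) ⟩
      -- 2Y is replaced by e_d + e_(d+1); the sign change between d and d+1 then makes the terms in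
      -- e_(d+1) cancel.
      P * (s * ¼ * (ι 2 * Y)) + (sgn n - P * s * ¼ * e (suc d))    ≈⟨ ≈-+ (≈-scale 2 (≈-*ˡ (integral-* (integral-sgn d) integral-¼) (≈-sym (e-recurrence d)))) (≈-refl {3} {sgn n - P * s * ¼ * e (suc d)}) ⟩
      P * (s * ¼ * (e d + e (suc d))) + (sgn n - P * s * ¼ * e (suc d))   ≈⟨ ≈-reflexive (finish P s (e d) (e (suc d)) (sgn n)) ⟩
      sgn n + P * s * ¼ * e d                                      ∎
      where
      open ≈-Reasoning (≈-setoid 3)
      s Y : ℚ
      s = sgn d
      Y = powℚ (ι d + ½) (2 ℕ.* h)
      insert : ∀ a b → a ≡ a - b + b
      insert = solve-∀ ring
      prepare : ∀ P s Y t e → P * (s * ½ * Y) + (t + P * (- 1ℚ * s) * ¼ * e) ≡ P * (s * ¼ * (ι 2 * Y)) + (t - P * s * ¼ * e)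
      prepare = solve-∀ ring
      finish : ∀ P s e e′ t → P * (s * ¼ * (e + e′)) + (t - P * s * ¼ * e′) ≡ t + P * s * ¼ * e
      finish = solve-∀ ring

    -- The descent is repeated modulo p², because reducing `S-mod-p³` would call for the
    -- p-integrality of `e d`.
    S-mod-p² : ∀ r d → d ℕ.+ r ≡ n → S d ≈[ 2 ] sgn n
    S-mod-p² zero d d+0≡n = subst (λ k → S k ≈[ 2 ] sgn n)
      (trans (sym d+0≡n) (ℕₚ.+-identityʳ d))
      (≈-trans (≈-reflexive (sum-summand-top n)) (≈-weaken 1 Morley))
    S-mod-p² (suc r) d eq = begin
      S d                              ≈⟨ ≈-reflexive (insert (S d) (S (suc d))) ⟩
      S d - S (suc d) + S (suc d)      ≈⟨ ≈-+ (≈-trans (≈-weaken 1 (S-difference d (proj₁ (d+suc eq)))) (p^m≈0 2 integral-c)) (S-mod-p² r (suc d) (proj₂ (d+suc eq))) ⟩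
      0ℚ + sgn n                       ≈⟨ ≈-reflexive (ℚₚ.+-identityˡ (sgn n)) ⟩
      sgn n                            ∎
      where
      open ≈-Reasoning (≈-setoid 2)
      integral-c : Integral p (sgn d * ½ * powℚ (ι d + ½) (2 ℕ.* h))
      integral-c = integral-* (integral-* (integral-sgn d) integral-½) (integral-pow (2 ℕ.* h) (integral-+ (integral-ι d) integral-½))
      insert : ∀ a b → a ≡ a - b + b
      insert = solve-∀ ring

    -- Interpolates between S(i) = `V 0 i` and the sum of the first congruence, `V (2 ℕ.* d) d`, so
    -- that Pascal's rule can remove the extra m one unit at a time.
    V : ℕ → ℕ → ℚ
    V m i = sumTo n (λ k → ι (((2 ℕ.* k) C k) ℕ.* ((2 ℕ.* k ℕ.+ m) C (k ℕ.+ i))) * powℚ 1/16 k)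

    V-Pascal : ∀ m i → V (suc m) (suc i) ≡ V m i + V m (suc i)
    V-Pascal m i = trans (sumTo-cong n term) (sumTo-+ n _ _)
      where
      open ≡-Reasoning
      term : ∀ k → ι (((2 ℕ.* k) C k) ℕ.* ((2 ℕ.* k ℕ.+ suc m) C (k ℕ.+ suc i))) * powℚ 1/16 k
        ≡ ι (((2 ℕ.* k) C k) ℕ.* ((2 ℕ.* k ℕ.+ m) C (k ℕ.+ i))) * powℚ 1/16 k
        + ι (((2 ℕ.* k) C k) ℕ.* ((2 ℕ.* k ℕ.+ m) C (k ℕ.+ suc i))) * powℚ 1/16 k
      term k = begin
        ι (a ℕ.* ((2 ℕ.* k ℕ.+ suc m) C (k ℕ.+ suc i))) * q   ≡⟨ cong (λ c → ι (a ℕ.* c) * q) pascal ⟩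
        ι (a ℕ.* (b ℕ.+ c)) * q                               ≡⟨ cong (λ u → ι u * q) (ℕₚ.*-distribˡ-+ a b c) ⟩
        ι (a ℕ.* b ℕ.+ a ℕ.* c) * q                           ≡⟨ cong (_* q) (ι-+ (a ℕ.* b) (a ℕ.* c)) ⟩
        (ι (a ℕ.* b) + ι (a ℕ.* c)) * q                       ≡⟨ ℚₚ.*-distribʳ-+ q (ι (a ℕ.* b)) (ι (a ℕ.* c)) ⟩
        ι (a ℕ.* b) * q + ι (a ℕ.* c) * q                     ∎
        where
        a b c : ℕ
        a = (2 ℕ.* k) C k
        b = (2 ℕ.* k ℕ.+ m) C (k ℕ.+ i)
        c = (2 ℕ.* k ℕ.+ m) C (k ℕ.+ suc i)
        q : ℚ
        q = powℚ 1/16 k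
        pascal : (2 ℕ.* k ℕ.+ suc m) C (k ℕ.+ suc i) ≡ b ℕ.+ c
        pascal = trans (cong₂ _C_ (ℕₚ.+-suc (2 ℕ.* k) m) (ℕₚ.+-suc k i))
          (trans (sym (nCk+nC[k+1]≡[n+1]C[k+1] (2 ℕ.* k ℕ.+ m) (k ℕ.+ i)))
            (cong (λ j → b ℕ.+ ((2 ℕ.* k ℕ.+ m) C j)) (sym (ℕₚ.+-suc k i))))

    -- Stands in for negative offsets: at i = 0 Pascal's rule would lead to i = -1, so the lower
    -- index k is first reflected to k + m.
    V-symmetric : ∀ m → V m 0 ≡ V m m
    V-symmetric m = sumTo-cong n (λ k → cong (λ c → ι (((2 ℕ.* k) C k) ℕ.* c) * powℚ 1/16 k) (reflect k))
      where
      split : ∀ k m → 2 ℕ.* k ℕ.+ m ≡ k ℕ.+ (k ℕ.+ m)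
      split = ℕ-RingSolver.solve-∀
      reflect : ∀ k → (2 ℕ.* k ℕ.+ m) C (k ℕ.+ 0) ≡ (2 ℕ.* k ℕ.+ m) C (k ℕ.+ m)
      reflect k = begin
        (2 ℕ.* k ℕ.+ m) C (k ℕ.+ 0)                   ≡⟨ cong₂ _C_ (split k m) (ℕₚ.+-identityʳ k) ⟩
        (k ℕ.+ (k ℕ.+ m)) C k                         ≡⟨ nCk≡nC[n∸k] (ℕₚ.m≤m+n k (k ℕ.+ m)) ⟩
        (k ℕ.+ (k ℕ.+ m)) C (k ℕ.+ (k ℕ.+ m) ℕ.∸ k)   ≡⟨ cong₂ _C_ (sym (split k m)) (ℕₚ.m+n∸m≡n k (k ℕ.+ m)) ⟩
        (2 ℕ.* k ℕ.+ m) C (k ℕ.+ m)                   ∎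
        where open ≡-Reasoning

    -- Repeated Pascal steps lead from `V m i` to S(j) with i-m ≤ j ≤ i, where S(-j) = S(j); the two
    -- bounds keep |j| ≤ n throughout. Every step doubles the common value (-1)^n.
    V-mod-p² : ∀ m i → i ℕ.≤ n → m ℕ.≤ n ℕ.+ i → V m i ≈[ 2 ] powℚ (ι 2) m * sgn n
    -- Stated apart because the case i = 0 takes such a step too, after its reflection to offset
    -- m+1.
    V-step : ∀ m i → suc i ℕ.≤ n → m ℕ.≤ n ℕ.+ i → V (suc m) (suc i) ≈[ 2 ] powℚ (ι 2) (suc m) * sgn n

    V-mod-p² zero    i       i≤n _    = ≈-trans
      (≈-reflexive (sumTo-cong n (λ k → cong (λ N → ι (((2 ℕ.* k) C k) ℕ.* (N C (k ℕ.+ i))) * powℚ 1/16 k) (ℕₚ.+-identityʳ (2 ℕ.* k)))))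
      (≈-trans (S-mod-p² (n ℕ.∸ i) i (ℕₚ.m+[n∸m]≡n i≤n)) (≈-reflexive (sym (ℚₚ.*-identityˡ (sgn n)))))
    V-mod-p² (suc m) zero    _   m<n+0 = ≈-trans (≈-reflexive (V-symmetric (suc m)))
      (V-step m m (subst (suc m ℕ.≤_) (ℕₚ.+-identityʳ n) m<n+0) (ℕₚ.m≤n+m m n))
    V-mod-p² (suc m) (suc i) i<n m<   = V-step m i i<n (ℕ.s≤s⁻¹ (subst (suc m ℕ.≤_) (ℕₚ.+-suc n i) m<))

    V-step m i i<n m≤n+i = begin
      V (suc m) (suc i)                                    ≈⟨ ≈-reflexive (V-Pascal m i) ⟩
      V m i + V m (suc i)                                  ≈⟨ ≈-+ (V-mod-p² m i (ℕₚ.<⇒≤ i<n) m≤n+i) (V-mod-p² m (suc i) i<n (ℕₚ.≤-trans m≤n+i (ℕₚ.+-monoʳ-≤ n (ℕₚ.n≤1+n i)))) ⟩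
      powℚ (ι 2) m * sgn n + powℚ (ι 2) m * sgn n          ≈⟨ ≈-reflexive (double (powℚ (ι 2) m) (sgn n)) ⟩
      powℚ (ι 2) (suc m) * sgn n                           ∎
      where
      open ≈-Reasoning (≈-setoid 2)
      double : ∀ a s → a * s + a * s ≡ ι 2 * a * s
      double = solve-∀ ring

    first-congruence : ∀ d → d ℕ.≤ n → V (2 ℕ.* d) d ≈[ 2 ] ζ ((ℤ.+ (4 ℕ.^ d)) ℤ.* legendre ℤ.-1ℤ p)
    first-congruence d d≤n = ≈-trans
      (V-mod-p² (2 ℕ.* d) d d≤n (subst (ℕ._≤ n ℕ.+ d) (cong (d ℕ.+_) (sym (ℕₚ.+-identityʳ d))) (ℕₚ.+-monoˡ-≤ d d≤n)))
      (≈-reflexive (sym (begin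
        ζ ((ℤ.+ (4 ℕ.^ d)) ℤ.* legendre ℤ.-1ℤ p)     ≡⟨ ζ-* (ℤ.+ (4 ℕ.^ d)) (legendre ℤ.-1ℤ p) ⟩
        ι (4 ℕ.^ d) * ζ (legendre ℤ.-1ℤ p)           ≡⟨ cong₂ _*_ (trans (ι-^ 4 d) (powℚ-powℚ (ι 2) 2 d)) legendre≡sgn ⟩
        powℚ (ι 2) (2 ℕ.* d) * sgn n                 ∎)))
      where open ≡-Reasoning

    second-congruence : ∀ d → d ℕ.≤ n → S d ≈[ 3 ] ζ (legendre ℤ.-1ℤ p) + P * sgn d * ¼ * e d
    second-congruence d d≤n = ≈-trans (S-mod-p³ (n ℕ.∸ d) d (ℕₚ.m+[n∸m]≡n d≤n))
      (≈-reflexive (cong (λ u → u + P * sgn d * ¼ * e d) (sym legendre≡sgn)))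

  -- From a prime p > 3 to the parameters n and h

  odd-prime : ∀ {p} → Prime p → 3 ℕ.< p →
    ∃ λ n → ∃ λ h → p ≡ suc (2 ℕ.* n) × 2 ℕ.* n ≡ suc (suc (2 ℕ.* h))
  odd-prime {p} p-prime 3<p with parity p
  ... | inj₁ (k , refl) with prime⇒irreducible p-prime (m∣m*n {2} k)
  ...   | inj₂ 2≡p = contradiction (subst (3 ℕ.<_) (sym 2≡p) 3<p) λ { (s≤s (s≤s ())) }
  odd-prime _ (s≤s ()) | inj₂ (zero , refl)
  odd-prime _ _        | inj₂ (suc h , p≡) = suc h , h , p≡ , 2*suc h

  [p∸1]/2≡n : ∀ {p n} → p ≡ suc (2 ℕ.* n) → (p ℕ.∸ 1) ℕ./ 2 ≡ n
  [p∸1]/2≡n {n = n} refl = trans (cong (ℕ._/ 2) (ℕₚ.*-comm 2 n)) (m*n/n≡m n 2)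

  -- `N` and `m` are variables tied to n and 2h by equations, so that (p-1)/2 and p-3, in the form
  -- in which the theorem has them, can be exchanged for n and 2h by matching.
  congruences : ∀ p → Prime p → 3 ℕ.< p → ∀ n h → p ≡ suc (2 ℕ.* n) → 2 ℕ.* n ≡ suc (suc (2 ℕ.* h)) →
    ∀ N m → N ≡ n → m ≡ 2 ℕ.* h → ∀ d → d ℕ.≤ N →
    (sumTo N (λ k → ι (((2 ℕ.* k) C k) ℕ.* ((2 ℕ.* k ℕ.+ 2 ℕ.* d) C (k ℕ.+ d))) * powℚ 1/16 k)
      ≡ ζ ((ℤ.+ (4 ℕ.^ d)) ℤ.* legendre ℤ.-1ℤ p) [mod p ^ 2 ])
    × (sumTo N (summand d)
      ≡ ζ (legendre ℤ.-1ℤ p) + ι (p ℕ.^ 2) * sgn d * ((ℤ.+ 1) ℚ./ 4) * eulerPoly m (ι d + ½) [mod p ^ 3 ])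
  congruences p p-prime 3<p n h p≡ 2n≡ _ _ refl refl d d≤n =
    ≈⇒mod (first-congruence d d≤n) , ≈⇒mod (second-congruence d d≤n)
    where open Odd p p-prime n h p≡ 2n≡ 3<p

open Lemmas using (odd-prime; congruences; [p∸1]/2≡n)

open import Data.Nat using (_+_; _*_; _^_; _∸_; _<_; _≤_; _/_)
open import Data.Integer using (+_; -1ℤ)

theorem1p2 : (p : ℕ) → Prime p → 3 < p → (d : ℕ) → d ≤ (p ∸ 1) / 2 →
    (sumTo ((p ∸ 1) / 2)
    (λ k → ℕ→ℚ (((2 * k) C k) * ((2 * k + 2 * d) C (k + d))) ℚ.* powℚ ((+ 1) ℚ./ 16) k)
    ≡ ℤ→ℚ ((+ (4 ^ d)) ℤ.* legendre -1ℤ p) [mod p ^ 2 ])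
    × (sumTo ((p ∸ 1) / 2)
    (λ k → ℕ→ℚ (((2 * k) C k) * ((2 * k) C (k + d))) ℚ.* powℚ ((+ 1) ℚ./ 16) k)
    ≡ ℤ→ℚ (legendre -1ℤ p)
    ℚ.+ ℕ→ℚ (p ^ 2) ℚ.* powℚ (ℚ.- ℚ.1ℚ) d ℚ.* ((+ 1) ℚ./ 4)
    ℚ.* eulerPoly (p ∸ 3) (ℕ→ℚ d ℚ.+ ½)
    [mod p ^ 3 ])
theorem1p2 p p-prime 3<p d d≤[p∸1]/2 =
  let n , h , p≡1+2n , 2n≡2+2h = odd-prime p-prime 3<p
  in congruences p p-prime 3<p n h p≡1+2n 2n≡2+2h ((p ∸ 1) / 2) (p ∸ 3) ([p∸1]/2≡n p≡1+2n)
       (cong (_∸ 3) (trans p≡1+2n (cong suc 2n≡2+2h))) d d≤[p∸1]/2
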